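{- For every integer $n\geq 1$, the algorithm $\mathrm{EnumBPiso}$ (described in the context) on input $n$ enumerates $\mathsf{BP}_n^\star$: identifying each output with the partitioned order it represents, all outputs belong to $\mathsf{BP}_n$, and for every equivalence class of $\equiv_\star$ on $\mathsf{BP}_n$ exactly one output (counted with multiplicity) belongs to that class.
   Context: Notation: $\llbracket n\rrbracket=\{0,\dots,n-1\}$. A partitioned order of $\llbracket n\rrbracket$ is an (unordered) set $\{S_k\}_{k\in\llbracket s\rrbracket}$ of $s$ sequences $S_k=(i^k_0,\dots,i^k_{n_k-1})$ with $n_k>0$, each consisting of pairwise distinct elements of $\llbracket n\rrbracket$, the sequences being pairwise disjoint (as sets of entries) with union $\llbracket n\rrbracket$. The sequences are called o-blocks. $\mathsf{BP}_n$ is the set of all partitioned orders of $\llbracket n\rrbracket$ (block-parallel update modes of size $n$). For $\mu=\{S_k\}_{k\in\llbracket s\rrbracket}\in\mathsf{BP}_n$, let $p=\mathrm{lcm}(n_0,\dots,n_{s-1})$ and define the sequence of blocks $\varphi(\mu)=(W_\ell)_{\ell\in\llbracket p\rrbracket}$ by $W_\ell=\{i^k_{\ell \bmod n_k}\mid k\in\llbracket s\rrbracket\}$; write $|\varphi(\mu)|=p$. $\sigma^i$ denotes the circular shift of order $i\in\mathbb{Z}$ on finite sequences, moving the element at position $0$ to position $i$ (positions modulo the length). For $\mu,\mu'\in\mathsf{BP}_n$, $\mu\equiv_\star\mu'$ means $\varphi(\mu)=\sigma^i(\varphi(\mu'))$ for some $i\in\llbracket|\varphi(\mu')|\rrbracket$;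 $\mathsf{BP}_n^\star=\mathsf{BP}_n/\equiv_\star$. Integer partitions: the integer partitions of $n$ are listed in some fixed order; $d(i)$ is the maximal part size of the $i$-th partition, and $m(i,j)$ is the multiplicity of the part of size $j$ in it (possibly $0$). Matrix representation: a list $M=(M_1,\dots,M_{d(i)})$, where $M_j$ is a matrix with $m(i,j)$ rows and $j$ columns (empty if $m(i,j)=0$) such that each element of $\llbracket n\rrbracket$ is an entry exactly once overall, represents the partitioned order whose o-blocks are all the rows of all the matrices (each row read from left to right). Algorithm $\mathrm{EnumBPiso}(n)$: for each partition $i$ of $n$: set $b\leftarrow 1$; for $j$ going down from $d(i)$ to $1$: if $m(i,j)>0$, set $a[j]\leftarrow\gcd(b,j)$ and then $b\leftarrow\mathrm{lcm}(b,j)$; otherwise set $a[j]\leftarrow j$. Then call $\mathrm{Aux}(n,i,1,a)$. $\mathrm{Aux}(n,i,j,a,M_1,\dots,M_{j-1})$: (1) If $d(i)<j$, output $M=(M_1,\dots,M_{j-1})$ and return. (2) Otherwise, if $m(i,j)>0$: for each subset $A$ of size $j\cdot m(i,j)$ of the elements of $\llbracket n\rrbracket$ not occurring in $M_1,\dots,M_{j-1}$, let $\min_j=\min(A)$, and for each matrix $M_j$ enumerated by $\mathrm{Block}(A,j,m(i,j),\min_j,a[j])$, call $\mathrm{Aux}(n,i,j+1,a,M_1,\dots,M_{j-1},M_j)$. (3) Otherwise ($m(i,j)=0$), call $\mathrm{Aux}(n,i,j+1,a,M_1,\dots,M_{j-1},\emptyset)$. $\mathrm{Block}(A,j,m,\min_j,a_j)$: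 for each list of columns $C=(C_1,\dots,C_j)$ enumerated by $\mathrm{BlockAux}(A,j,m,\min_j,a_j)$, enumerate the matrix $M_j$ with $M_j[k][\ell]=C_\ell[k]$ for $1\le k\le m$, $1\le\ell\le j$, where the elements of each set $C_\ell$ are listed in some fixed order (e.g. increasing) as $C_\ell[1],\dots,C_\ell[m]$. $\mathrm{BlockAux}(A,j,m,\min_j,a_j,C_1,\dots,C_\ell)$: (i) If $A=\emptyset$, enumerate $(C_1,\dots,C_\ell)$ and return. (ii) Otherwise, if $|A|=m\cdot(j-a_j+1)$ and $\min_j\in A$: for each subset $B\subseteq A\setminus\{\min_j\}$ of size $m-1$, call $\mathrm{BlockAux}(A\setminus(B\cup\{\min_j\}),j,m,\min_j,a_j,C_1,\dots,C_\ell,B\cup\{\min_j\})$. (iii) Otherwise, for each subset $B\subseteq A$ of size $m$, call $\mathrm{BlockAux}(A\setminus B,j,m,\min_j,a_j,C_1,\dots,C_\ell,B)$. -}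

module Defs where

open import Data.Fin as Fin using (Fin; toℕ; fromℕ<)
open import Data.Fin.Properties using (nonZeroIndex)
open import Data.Fin.Subset using (Subset; inside; outside; ⁅_⁆; ⋃; ∁; _∪_; _─_; _-_; ∣_∣; Nonempty; _⊆_; _⊂_) renaming (_∈_ to _∈ₛ_)
open import Data.Fin.Subset.Induction using (⊂-wellFounded)
open import Data.Fin.Subset.Properties using (_∈?_; _⊆?_; nonempty?; Empty-unique; ∣⊥∣≡0; p∩q≢∅⇒p─q⊂p; x∈p∩q⁺; q⊆p∪q; x∈⁅x⁆)
open import Data.Integer as ℤ using (ℤ; _%ℕ_)
open import Data.Integer.DivMod using (n%ℕd<d)
open import Data.List using (List; []; _∷_; [_]; _∷ʳ_; map; concat; concatMap; filter; foldr; length; lookup; tabulate; replicate; zipWith; upTo; cartesianProductWith)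
open import Data.List.Extrema.Nat using (max)
open import Data.List.Membership.Propositional using (_∈_; mapWith∈)
open import Data.List.Membership.Propositional.Properties using (∈-filter⁻)
open import Data.List.NonEmpty as List⁺ using (List⁺; toList)
open import Data.List.Relation.Binary.Disjoint.Propositional using (Disjoint)
open import Data.List.Relation.Binary.Permutation.Propositional using (_↭_)
open import Data.List.Relation.Unary.All using (All)
open import Data.List.Relation.Unary.AllPairs using (AllPairs)
open import Data.List.Relation.Unary.Any using (Any)
open import Data.List.Relation.Unary.Linked using (Linked)
open import Data.List.Relation.Unary.Unique.Propositional using (Unique)
open import Data.Nat using (ℕ; zero; suc; NonZero; _+_; _*_; _∸_; _<_; _≤_; _≥_; _>_; s≤s; _≟_; _<?_; >-nonZero)
open import Data.Nat.DivMod using (_mod_)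
open import Data.Nat.GCD using (gcd)
open import Data.Nat.Induction using (<-wellFounded)
open import Data.Nat.LCM using (lcm)
open import Data.Nat.ListAction using (sum)
open import Data.Nat.Properties using (∸-monoʳ-<; ≤-refl; ≮⇒≥; m*n≢0)
open import Data.Product using (_×_; _,_; proj₂; ∃)
open import Data.Vec as Vec using ()
open import Function using (_∘_; _⇔_)
open import Induction.WellFounded using (Acc; acc)
open import Relation.Binary.PropositionalEquality using (_≡_; sym; trans; cong)
open import Relation.Nullary using (yes; no)
open import Relation.Nullary.Decidable using (_×-dec_)

private
  variable
    n : ℕ

-- The list of o-blocks stands for the unordered set of o-blocks, so two
-- values are the same partitioned order when these lists are related by _↭_.
record BP (n : ℕ) : Set where
  field
    oblocks  : List (List⁺ (Fin n))
    distinct : All (Unique ∘ toList) oblocks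
    disjoint : AllPairs (λ S T → Disjoint (toList S) (toList T)) oblocks
    cover    : ∀ x → Any (λ S → x ∈ toList S) oblocks

open BP public

period : BP n → ℕ
period μ = foldr lcm 1 (map List⁺.length (oblocks μ))

W : BP n → ℕ → Subset n
W μ ℓ = ⋃ (map (λ S → ⁅ lookup (toList S) (ℓ mod List⁺.length S) ⁆) (oblocks μ))

φ : BP n → List (Subset n)
φ μ = map (W μ) (upTo (period μ))

-- The element at position k - i (modulo the length) ends up at position k.
σ : {A : Set} → ℤ → List A → List A
σ i xs = tabulate {n = length xs} λ k →
  let instance _ = nonZeroIndex k
  in lookup xs (fromℕ< (n%ℕd<d (ℤ.+ toℕ k ℤ.- i) (length xs)))

infix 4 _≡⋆_

_≡⋆_ : BP n → BP n → Set
μ ≡⋆ μ′ = ∃ λ (i : Fin (length (φ μ′))) → φ μ ≡ σ (ℤ.+ toℕ i) (φ μ′)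

IsPartition : ℕ → List ℕ → Set
IsPartition n p = Linked _≥_ p × All (_> 0) p × sum p ≡ n

maxPart : List ℕ → ℕ
maxPart p = max 0 p

mult : List ℕ → ℕ → ℕ
mult p j = length (filter (j ≟_) p)

-- The two orders that the algorithm takes as fixed but arbitrary: the listing
-- of the integer partitions of n, and the listing of the elements of a set.
record FixedOrders (n : ℕ) : Set where
  field
    partitions          : List (List ℕ)
    partitions-sound    : All (IsPartition n) partitions
    partitions-complete : ∀ p → IsPartition n p → p ∈ partitions
    partitions-unique   : Unique partitions
    elements            : Subset n → List (Fin n)
    elements-∈          : ∀ C x → x ∈ elements C ⇔ x ∈ₛ C
    elements-unique     : ∀ C → Unique (elements C)

-- A matrix is the list of its rows.
Matrix : ℕ → Set
Matrix n = List (List (Fin n))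

infix 4 _represents_

_represents_ : List (Matrix n) → BP n → Set
Ms represents μ = concat Ms ↭ map toList (oblocks μ)

allSubsets : ∀ n → List (Subset n)
allSubsets zero    = [ Vec.[] ]
allSubsets (suc n) = cartesianProductWith Vec._∷_ (inside ∷ outside ∷ []) (allSubsets n)

choose : ℕ → Subset n → List (Subset n)
choose k A = filter (λ B → (B ⊆? A) ×-dec (∣ B ∣ ≟ k)) (allSubsets _)

choose-sound : ∀ k (A : Subset n) {B} → B ∈ choose k A → B ⊆ A × ∣ B ∣ ≡ k
choose-sound k A =
  proj₂ ∘ ∈-filter⁻ (λ B → (B ⊆? A) ×-dec (∣ B ∣ ≟ k)) {xs = allSubsets _}

∣∣-nonempty : ∀ (B : Subset n) {k} .{{_ : NonZero k}} → ∣ B ∣ ≡ k → Nonempty B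
∣∣-nonempty {n} B {suc k} eq with nonempty? B
... | yes ne = ne
... | no  em with () ← trans (sym (trans (cong ∣_∣ (Empty-unique em)) (∣⊥∣≡0 n))) eq

min : (A : Subset n) → Nonempty A → Fin n
min (inside  Vec.∷ A) _                           = Fin.zero
min (outside Vec.∷ A) (Fin.suc x , Vec.there x∈A) = Fin.suc (min A (x , x∈A))

-- The accumulator Cs holds (C₁ , … , C_ℓ).
module _ (j m : ℕ) .{{_ : NonZero m}} (minⱼ : Fin n) (aⱼ : ℕ) where

  blockAux : (A : Subset n) → Acc _⊂_ A → List (Subset n) → List (List (Subset n))
  blockAux A (acc rec) Cs with nonempty? A
  ... | no  _ = [ Cs ]
  ... | yes _ with (∣ A ∣ ≟ m * (j ∸ aⱼ + 1)) ×-dec (minⱼ ∈? A)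
  ...   | yes (_ , min∈A) =
    concatMap
      (λ B → blockAux (A ─ (B ∪ ⁅ minⱼ ⁆))
               (rec (p∩q≢∅⇒p─q⊂p A (B ∪ ⁅ minⱼ ⁆)
                 (minⱼ , x∈p∩q⁺ (min∈A , q⊆p∪q B ⁅ minⱼ ⁆ (x∈⁅x⁆ minⱼ)))))
               (Cs ∷ʳ (B ∪ ⁅ minⱼ ⁆)))
      (choose (m ∸ 1) (A - minⱼ))
  ...   | no  _ =
    concat (mapWith∈ (choose m A) λ {B} B∈ →
      let B⊆A , ∣B∣≡m = choose-sound m A B∈
          x , x∈B     = ∣∣-nonempty B ∣B∣≡m
      in blockAux (A ─ B)
           (rec (p∩q≢∅⇒p─q⊂p A B (x , x∈p∩q⁺ (B⊆A x∈B , x∈B))))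
           (Cs ∷ʳ B))

_[_≔_] : (ℕ → ℕ) → ℕ → ℕ → (ℕ → ℕ)
(a [ j ≔ v ]) k with k ≟ j
... | yes _ = v
... | no  _ = a k

-- The loop from j down to 1, started in the state (b , a).
fillA : (p : List ℕ) (j b : ℕ) → (ℕ → ℕ) → (ℕ → ℕ)
fillA p zero    b a = a
fillA p (suc j) b a with 0 <? mult p (suc j)
... | yes _ = fillA p j (lcm b (suc j)) (a [ suc j ≔ gcd b (suc j) ])
... | no  _ = fillA p j b (a [ suc j ≔ suc j ])

module _ (o : FixedOrders n) where
  open FixedOrders o

  -- The m-row matrix whose ℓ-th column lists the elements of C_ℓ.
  fromColumns : ℕ → List (Subset n) → Matrix n
  fromColumns m Cs = foldr (zipWith _∷_) (replicate m []) (map elements Cs)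

  block : (A : Subset n) (j m : ℕ) .{{_ : NonZero m}} → Fin n → ℕ → List (Matrix n)
  block A j m minⱼ aⱼ =
    map (fromColumns m) (blockAux j m minⱼ aⱼ A (⊂-wellFounded A) [])

  unused : List (Matrix n) → Subset n
  unused Ms = ∁ (⋃ (map ⁅_⁆ (concat (concat Ms))))

  -- The accumulator Ms holds (M₁ , … , M_{j-1}).
  aux : (p : List ℕ) (a : ℕ → ℕ) (j : ℕ) .{{_ : NonZero j}} →
        Acc _<_ (suc (maxPart p) ∸ j) → List (Matrix n) → List (List (Matrix n))
  aux p a j (acc rec) Ms with maxPart p <? j
  ... | yes _   = [ Ms ]
  ... | no  d≮j with 0 <? mult p j
  ...   | yes 0<m =
    concat (mapWith∈ (choose (j * mult p j) (unused Ms)) λ {A} A∈ →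
      let instance
            m≢0  = >-nonZero 0<m
            jm≢0 = m*n≢0 j (mult p j)
          minⱼ = min A (∣∣-nonempty A (proj₂ (choose-sound (j * mult p j) (unused Ms) A∈)))
      in concatMap
           (λ Mⱼ → aux p a (suc j) (rec (∸-monoʳ-< ≤-refl (s≤s (≮⇒≥ d≮j)))) (Ms ∷ʳ Mⱼ))
           (block A j (mult p j) minⱼ (a j)))
  ...   | no  _ =
    aux p a (suc j) (rec (∸-monoʳ-< ≤-refl (s≤s (≮⇒≥ d≮j)))) (Ms ∷ʳ [])

  EnumBPiso : List (List (Matrix n))
  EnumBPiso = concatMap
    (λ p → aux p (fillA p (maxPart p) 1 (λ _ → 0)) 1 (<-wellFounded _) [])
    partitions

{-# OPTIONS --safe #-}

-- Write a partitioned order in coordinates: every x lies in an o-block of some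
-- size sz x, at some position pos x. The block W t contains x exactly when
-- t mod sz x = pos x, so μ ≡⋆ μ′ means that sz agrees and that pos differs by
-- one common shift i, taken modulo sz x. The outputs of EnumBPiso are, without
-- repetition, the coordinates in which, for every size k that occurs, the
-- chosen element min A_k has position below a[k] = gcd(b, k), where b is the lcm
-- of the larger sizes that occur. Going down through the sizes, a shift that
-- fixes the positions of the larger minima is a multiple of b, and the multiples
-- of b act on the positions modulo k with {0, …, gcd(b, k) - 1} as a set of
-- representatives: so each class contains exactly one normalised element.

module Submission where

open import Defs
open import Data.Bool using (true; false)
open import Data.Empty using (⊥-elim)
open import Data.Fin using (Fin; toℕ; fromℕ<)
import Data.Fin as Fin
import Data.Fin.Properties as Finₚ
open import Data.Fin.Subset hiding (Side) renaming (_∈_ to _∈ₛ_; _∉_ to _∉ₛ_; ⊥ to ∅; ⊤ to full)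
open import Data.Fin.Subset.Induction using (⊂-wellFounded)
open import Data.Fin.Subset.Properties
open import Data.Integer as ℤ using (ℤ; _%ℕ_; _/ℕ_)
open import Data.Integer.DivMod using (a≡a%ℕn+[a/ℕn]*n; n%ℕd<d)
import Data.Integer.Properties as ℤₚ
open import Data.List using (List; []; _∷_; _++_; _∷ʳ_; [_]; map; concat; concatMap; filter; foldr; length; lookup; tabulate; replicate; zipWith; upTo; applyUpTo)
import Data.List.Extrema.Nat as Extrema
open import Data.List.Membership.Propositional using (_∈_; _∉_; mapWith∈; find; lose)
open import Data.List.Membership.Propositional.Properties
open import Data.List.NonEmpty as List⁺ using (List⁺; toList)
import Data.List.Properties as Listₚ
open import Data.List.Relation.Binary.Disjoint.Propositional using (Disjoint)
open import Data.List.Relation.Binary.Permutation.Propositional using (_↭_; ↭-refl; ↭-trans; ↭-sym; prep; ↭-reflexive; ↭⇒↭ₛ)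
import Data.List.Relation.Binary.Permutation.Propositional.Properties as ↭ₚ
import Data.List.Relation.Binary.Permutation.Setoid.Properties as ↭ₛ
open import Data.List.Relation.Unary.All using (All; []; _∷_)
import Data.List.Relation.Unary.All as All
import Data.List.Relation.Unary.All.Properties as Allₚ
open import Data.List.Relation.Unary.AllPairs using (AllPairs; []; _∷_)
import Data.List.Relation.Unary.AllPairs as AllPairs
import Data.List.Relation.Unary.AllPairs.Properties as AllPairsₚ
open import Data.List.Relation.Unary.Any using (Any; here; there)
import Data.List.Relation.Unary.Any as Any
import Data.List.Relation.Unary.Any.Properties as Anyₚ
open import Data.List.Relation.Unary.Linked.Properties using (Linked⇒AllPairs)
open import Data.List.Relation.Unary.Unique.Propositional using (Unique)
import Data.List.Relation.Unary.Unique.Propositional.Properties as Uniqueₚ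
import Data.List.Sort as Sort
open import Data.Nat hiding (∣_-_∣)
open import Data.Nat.Divisibility
open import Data.Nat.DivMod using (_mod_; m≡m%n+[m/n]*n; m%n<n; m%n%n≡m%n; m<n⇒m%n≡m; [m+n]%n≡m%n; [m+kn]%n≡m%n; %-congʳ; %-distribˡ-+; %-remove-+ʳ; m∣n⇒o%n%m≡o%m)
open import Data.Nat.GCD using (gcd; gcd[m,n]∣m; gcd[m,n]∣n; gcd[m,n]≢0; gcd-GCD; module Bézout)
open import Data.Nat.Induction using (<-wellFounded)
open import Data.Nat.LCM using (lcm; m∣lcm[m,n]; n∣lcm[m,n]; lcm-least)
open import Data.Nat.ListAction using (sum)
open import Data.Nat.ListAction.Properties using (sum-↭)
open import Data.Nat.Properties
open import Data.Nat.Tactic.RingSolver using (solve-∀)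
open import Data.Product using (_×_; _,_; proj₁; proj₂; ∃; ∃!; ∃₂)
open import Data.Sum using (_⊎_; inj₁; inj₂)
import Data.Vec as Vec
import Data.Vec.Properties as Vecₚ
open import Function using (_∘_; _⇔_; mk⇔; Equivalence; id; case_of_)
open import Induction.WellFounded using (acc)
import Relation.Binary.Construct.Flip.EqAndOrd as Flip
open import Relation.Binary.Definitions using (tri<; tri≈; tri>)
open import Relation.Binary.PropositionalEquality hiding ([_])
open import Relation.Nullary using (yes; no; ¬_; does; contradiction; _×-dec_)
open import Relation.Nullary.Decidable using (dec-true)
open import Relation.Unary using (Decidable)

open Equivalence using (to; from)

-- `sz` and `pos` forget which elements of equal size share an o-block, and so does every `W`. Hence
-- a column may be listed in any order: the rows change, the class does not. Outputs must therefore
-- be told apart by their coordinates and not merely as matrices. The forced column of `BlockAux` is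
-- the bound on the minimum in disguise: the minimum is placed at the latest when j - a + 1 columns
-- are left, so its column index ℓ satisfies ℓ + (j - a + 1) ≤ j, that is ℓ < a. A_k consists of all
-- elements of size k. A shift preserves sizes, so the minimum of A_k is the same reference point
-- throughout a class. By Bézout the multiples of b run, modulo k, through exactly the multiples of
-- gcd(b, k), and each coset of these has one member below gcd(b, k). `Aux` goes up through the
-- sizes while a is computed going down. The outputs are therefore described for a general a by the
-- predicate `Filling`, and the loop that fills a is analysed on its own. Shifts are natural numbers
-- throughout; where a negative one is needed, s - 1 plays the role of -1 modulo s.

private variable
  X Y : Set
  n : ℕ

-- Positions in lists

data Nth (P : X → Set) : List X → ℕ → Set where
  here  : ∀ {x xs} → P x → Nth P (x ∷ xs) zero
  there : ∀ {x xs ℓ} → Nth P xs ℓ → Nth P (x ∷ xs) (suc ℓ)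

Nth-map : ∀ {P Q : X → Set} → (∀ {x} → P x → Q x) → ∀ {xs ℓ} → Nth P xs ℓ → Nth Q xs ℓ
Nth-map f (here p)  = here (f p)
Nth-map f (there p) = there (Nth-map f p)

Nth-map⁺ : ∀ {P : Y → Set} {f : X → Y} {xs ℓ} → Nth (P ∘ f) xs ℓ → Nth P (map f xs) ℓ
Nth-map⁺ (here p)  = here p
Nth-map⁺ (there p) = there (Nth-map⁺ p)

Nth-map⁻ : ∀ {P : Y → Set} {f : X → Y} {xs ℓ} → Nth P (map f xs) ℓ → Nth (P ∘ f) xs ℓ
Nth-map⁻ {xs = _ ∷ _} (here p)  = here p
Nth-map⁻ {xs = _ ∷ _} (there p) = there (Nth-map⁻ p)

Nth⇒Any : ∀ {P : X → Set} {xs ℓ} → Nth P xs ℓ → Any P xs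
Nth⇒Any (here p)  = here p
Nth⇒Any (there p) = there (Nth⇒Any p)

Any⇒Nth : ∀ {P : X → Set} {xs} → Any P xs → ∃ (Nth P xs)
Any⇒Nth (here p)  = 0 , here p
Any⇒Nth (there p) = let ℓ , q = Any⇒Nth p in suc ℓ , there q

Nth⇒< : ∀ {P : X → Set} {xs ℓ} → Nth P xs ℓ → ℓ < length xs
Nth⇒< (here _)  = z<s
Nth⇒< (there p) = s<s (Nth⇒< p)

Nth-unique : ∀ {xs : List X} {x y ℓ} → Nth (_≡ x) xs ℓ → Nth (_≡ y) xs ℓ → x ≡ y
Nth-unique (here refl) (here refl) = refl
Nth-unique (there p)   (there q)   = Nth-unique p q

Nth-injective : ∀ {xs : List X} {x ℓ ℓ′} → Unique xs →
                Nth (_≡ x) xs ℓ → Nth (_≡ x) xs ℓ′ → ℓ ≡ ℓ′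
Nth-injective _         (here _)    (here _)    = refl
Nth-injective (x∉ ∷ _)  (here refl) (there q)   = contradiction refl (All.lookup x∉ (Any.map sym (Nth⇒Any q)))
Nth-injective (x∉ ∷ _)  (there p)   (here refl) = contradiction refl (All.lookup x∉ (Any.map sym (Nth⇒Any p)))
Nth-injective (_ ∷ xs!) (there p)   (there q)   = cong suc (Nth-injective xs! p q)

Nth-lookup : ∀ (xs : List X) i → Nth (_≡ lookup xs i) xs (toℕ i)
Nth-lookup (_ ∷ _)  Fin.zero    = here refl
Nth-lookup (_ ∷ xs) (Fin.suc i) = there (Nth-lookup xs i)

Nth-tabulate : ∀ {k} (f : Fin k → X) i → Nth (_≡ f i) (tabulate f) (toℕ i)
Nth-tabulate f Fin.zero    = here refl
Nth-tabulate f (Fin.suc i) = there (Nth-tabulate (f ∘ Fin.suc) i)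

Nth-ext : ∀ {xs ys : List X} (f : ℕ → X) → length xs ≡ length ys →
          (∀ {ℓ} → ℓ < length xs → Nth (_≡ f ℓ) xs ℓ) →
          (∀ {ℓ} → ℓ < length ys → Nth (_≡ f ℓ) ys ℓ) → xs ≡ ys
Nth-ext {xs = []}    {[]}    f _  p q = refl
Nth-ext {xs = _ ∷ _} {_ ∷ _} f eq p q with p z<s | q z<s
... | here refl | here refl =
  cong (_ ∷_) (Nth-ext (f ∘ suc) (suc-injective eq) (tail ∘ p ∘ s<s) (tail ∘ q ∘ s<s))
  where
  tail : ∀ {P : _ → Set} {x xs ℓ} → Nth P (x ∷ xs) (suc ℓ) → Nth P xs ℓ
  tail (there p) = p

-- Membership and pairwise relations in concatenated enumerations

module _ {xs : List X} (f : ∀ {x} → x ∈ xs → List Y) where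

  ∈-concat-mapWith∈⁻ : ∀ {y} → y ∈ concat (mapWith∈ xs f) → ∃₂ λ x (x∈ : x ∈ xs) → y ∈ f x∈
  ∈-concat-mapWith∈⁻ {y} y∈ with ∈-concat⁻′ (mapWith∈ xs f) y∈
  ... | _ , y∈ys , ys∈ with Anyₚ.mapWith∈⁻ xs f ys∈
  ... | x , x∈ , refl = x , x∈ , y∈ys

  ∈-concat-mapWith∈⁺ : ∀ {x y} (x∈ : x ∈ xs) → y ∈ f x∈ → y ∈ concat (mapWith∈ xs f)
  ∈-concat-mapWith∈⁺ x∈ y∈ = ∈-concat⁺′ y∈ (Anyₚ.mapWith∈⁺ f (_ , x∈ , refl))

-- The form in which nested loops are shown free of repetition: `inner` treats one branch, `outer`
-- two branches with different loop values. The membership proof is kept because the algorithm uses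
-- it, in `aux` for the minimum and in `blockAux` for termination.
AllPairs-concat-mapWith∈ :
  ∀ {R : Y → Y → Set} {xs : List X} (f : ∀ {x} → x ∈ xs → List Y) → Unique xs →
  (∀ {x} (x∈ : x ∈ xs) → AllPairs R (f x∈)) →
  (∀ {x x′} (x∈ : x ∈ xs) (x′∈ : x′ ∈ xs) → x ≢ x′ → ∀ {y y′} → y ∈ f x∈ → y′ ∈ f x′∈ → R y y′) →
  AllPairs R (concat (mapWith∈ xs f))
AllPairs-concat-mapWith∈ {xs = []} f [] _ _ = []
AllPairs-concat-mapWith∈ {xs = _ ∷ xs} f (x∉ ∷ xs!) inner outer =
  AllPairsₚ.++⁺ (inner (here refl))
    (AllPairs-concat-mapWith∈ (f ∘ there) xs! (inner ∘ there) (λ p q → outer (there p) (there q)))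
    (All.tabulate λ y∈ → All.tabulate λ y′∈ →
      let _ , x′∈ , y′∈f = ∈-concat-mapWith∈⁻ (f ∘ there) y′∈
      in outer (here refl) (there x′∈) (All.lookup x∉ x′∈) y∈ y′∈f)

AllPairs-concatMap :
  ∀ {R : Y → Y → Set} {xs : List X} (f : X → List Y) → Unique xs →
  (∀ {x} → x ∈ xs → AllPairs R (f x)) →
  (∀ {x x′} → x ∈ xs → x′ ∈ xs → x ≢ x′ → ∀ {y y′} → y ∈ f x → y′ ∈ f x′ → R y y′) →
  AllPairs R (concatMap f xs)
AllPairs-concatMap {R = R} {xs} f xs! inner outer =
  subst (AllPairs R ∘ concat) (mapWith∈≗map f xs)
    (AllPairs-concat-mapWith∈ (λ {x} _ → f x) xs! inner outer)

AllPairs-lookup : ∀ {R : X → X → Set} → (∀ {x y} → R x y → R y x) → ∀ {xs} → AllPairs R xs →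
                  ∀ i j → i ≢ j → R (lookup xs i) (lookup xs j)
AllPairs-lookup s (r ∷ rs) Fin.zero    Fin.zero    i≢j = contradiction refl i≢j
AllPairs-lookup s (r ∷ rs) Fin.zero    (Fin.suc j) i≢j = All.lookup r (∈-lookup j)
AllPairs-lookup s (r ∷ rs) (Fin.suc i) Fin.zero    i≢j = s (All.lookup r (∈-lookup i))
AllPairs-lookup s (r ∷ rs) (Fin.suc i) (Fin.suc j) i≢j = AllPairs-lookup s rs i j (i≢j ∘ cong Fin.suc)

Unique-++⁻ : ∀ (xs : List X) {ys} → Unique (xs ++ ys) → Unique xs × Unique ys × Disjoint xs ys
Unique-++⁻ []       ys! = [] , ys! , λ ()
Unique-++⁻ (x ∷ xs) (x∉ ∷ u) =
  let xs! , ys! , dis = Unique-++⁻ xs u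
  in Allₚ.++⁻ˡ xs x∉ ∷ xs! , ys! , λ
       { (here refl , v∈) → All.lookup (Allₚ.++⁻ʳ xs x∉) v∈ refl
       ; (there u∈  , v∈) → dis (u∈ , v∈) }

Unique-concat⁻ : ∀ (xss : List (List X)) → Unique (concat xss) → All Unique xss × AllPairs Disjoint xss
Unique-concat⁻ []         _ = [] , []
Unique-concat⁻ (xs ∷ xss) u =
  let xs! , rest! , dis = Unique-++⁻ xs u
      all , pairs = Unique-concat⁻ xss rest!
  in xs! ∷ all , All.tabulate (λ ys∈ → λ (x∈ , x∈ys) → dis (x∈ , ∈-concat⁺′ x∈ys ys∈)) ∷ pairs

-- Subsets of a finite set

subset-ext : {A B : Subset n} → (∀ x → x ∈ₛ A ⇔ x ∈ₛ B) → A ≡ B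
subset-ext h = ⊆-antisym (λ {x} → to (h x)) (λ {x} → from (h x))

x∈p─q⇒x∉q : ∀ {x} (p q : Subset n) → x ∈ₛ p ─ q → x ∉ₛ q
x∈p─q⇒x∉q (_ Vec.∷ p) (outside Vec.∷ q) Vec.here ()
x∈p─q⇒x∉q (_ Vec.∷ p) (_ Vec.∷ q) (Vec.there x∈) (Vec.there x∈q) = x∈p─q⇒x∉q p q x∈ x∈q

∣p─q∣+∣q∣≡∣p∣ : (p q : Subset n) → q ⊆ p → ∣ p ─ q ∣ + ∣ q ∣ ≡ ∣ p ∣
∣p─q∣+∣q∣≡∣p∣ Vec.[] Vec.[] _ = refl
∣p─q∣+∣q∣≡∣p∣ (inside  Vec.∷ p) (inside  Vec.∷ q) q⊆p =
  trans (+-suc _ _) (cong suc (∣p─q∣+∣q∣≡∣p∣ p q (drop-∷-⊆ q⊆p)))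
∣p─q∣+∣q∣≡∣p∣ (outside Vec.∷ p) (inside  Vec.∷ q) q⊆p with () ← q⊆p Vec.here
∣p─q∣+∣q∣≡∣p∣ (inside  Vec.∷ p) (outside Vec.∷ q) q⊆p = cong suc (∣p─q∣+∣q∣≡∣p∣ p q (drop-∷-⊆ q⊆p))
∣p─q∣+∣q∣≡∣p∣ (outside Vec.∷ p) (outside Vec.∷ q) q⊆p = ∣p─q∣+∣q∣≡∣p∣ p q (drop-∷-⊆ q⊆p)

x∈p⇒⁅x⁆⊆p : ∀ {x} {p : Subset n} → x ∈ₛ p → ⁅ x ⁆ ⊆ p
x∈p⇒⁅x⁆⊆p {p = p} x∈p y∈ = subst (_∈ₛ p) (sym (x∈⁅y⁆⇒x≡y _ y∈)) x∈p

∣p-x∣+1≡∣p∣ : ∀ {x} (p : Subset n) → x ∈ₛ p → ∣ p - x ∣ + 1 ≡ ∣ p ∣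
∣p-x∣+1≡∣p∣ {x = x} p x∈p =
  trans (cong (∣ p - x ∣ +_) (sym (∣⁅x⁆∣≡1 x))) (∣p─q∣+∣q∣≡∣p∣ p ⁅ x ⁆ (x∈p⇒⁅x⁆⊆p x∈p))

∣∣≡0⇒Empty : (p : Subset n) → ∣ p ∣ ≡ 0 → Empty p
∣∣≡0⇒Empty p eq (x , x∈p) with ∣ p - x ∣ + 1 | ∣p-x∣+1≡∣p∣ p x∈p | +-comm ∣ p - x ∣ 1
... | _ | e | refl with () ← trans e eq

∣∣≡length : ∀ {C : Subset n} {xs} → Unique xs → (∀ x → x ∈ xs ⇔ x ∈ₛ C) → ∣ C ∣ ≡ length xs
∣∣≡length {n} {C} {[]} [] h =
  trans (cong ∣_∣ (Empty-unique {p = C} λ (x , x∈) → case from (h x) x∈ of λ ())) (∣⊥∣≡0 n)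
∣∣≡length {C = C} {x ∷ xs} (x∉ ∷ xs!) h = begin
  ∣ C ∣          ≡⟨ ∣p-x∣+1≡∣p∣ C (to (h x) (here refl)) ⟨
  ∣ C - x ∣ + 1  ≡⟨ +-comm _ 1 ⟩
  suc ∣ C - x ∣  ≡⟨ cong suc (∣∣≡length xs! λ y → mk⇔ (fwd y) (bwd y)) ⟩
  suc (length xs) ∎
  where
  open ≡-Reasoning
  fwd : ∀ y → y ∈ xs → y ∈ₛ C - x
  fwd y y∈ = x∈p∧x≢y⇒x∈p-y (to (h y) (there y∈)) (All.lookup x∉ y∈ ∘ sym)
  bwd : ∀ y → y ∈ₛ C - x → y ∈ xs
  bwd y y∈ with from (h y) (p─q⊆p C ⁅ x ⁆ y∈)
  ... | here refl = contradiction (x∈⁅x⁆ y) (x∈p─q⇒x∉q C ⁅ x ⁆ y∈)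
  ... | there y∈xs = y∈xs

⟪_⟫ : {P : Fin n → Set} → Decidable P → Subset n
⟪ P? ⟫ = Vec.tabulate (does ∘ P?)

∈⟪⟫ : ∀ {P : Fin n → Set} (P? : Decidable P) x → x ∈ₛ ⟪ P? ⟫ ⇔ P x
∈⟪⟫ P? x = mk⇔ fwd bwd
  where
  fwd : x ∈ₛ ⟪ P? ⟫ → _
  fwd x∈ with P? x | trans (sym (Vecₚ.lookup∘tabulate (does ∘ P?) x)) (Vecₚ.[]=⇒lookup x∈)
  ... | yes p | _ = p
  bwd : _ → x ∈ₛ ⟪ P? ⟫
  bwd p = Vecₚ.lookup⇒[]= x _ (trans (Vecₚ.lookup∘tabulate (does ∘ P?) x) (dec-true (P? x) p))

∈-⋃⁺ : ∀ {x : Fin n} {Cs} → Any (x ∈ₛ_) Cs → x ∈ₛ ⋃ Cs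
∈-⋃⁺ {Cs = C ∷ Cs} (here x∈)  = x∈p∪q⁺ (inj₁ x∈)
∈-⋃⁺ {Cs = C ∷ Cs} (there x∈) = x∈p∪q⁺ (inj₂ (∈-⋃⁺ x∈))

∈-⋃⁻ : ∀ {x : Fin n} Cs → x ∈ₛ ⋃ Cs → Any (x ∈ₛ_) Cs
∈-⋃⁻ []       x∈ = contradiction x∈ ∉⊥
∈-⋃⁻ (C ∷ Cs) x∈ with x∈p∪q⁻ C (⋃ Cs) x∈
... | inj₁ x∈C  = here x∈C
... | inj₂ x∈Cs = there (∈-⋃⁻ Cs x∈Cs)

∈-allSubsets : (B : Subset n) → B ∈ allSubsets n
∈-allSubsets Vec.[]      = here refl
∈-allSubsets (s Vec.∷ B) = ∈-cartesianProductWith⁺ Vec._∷_ (side s) (∈-allSubsets B)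
  where
  side : ∀ s → s ∈ inside ∷ outside ∷ []
  side inside  = here refl
  side outside = there (here refl)

allSubsets-unique : ∀ n → Unique (allSubsets n)
allSubsets-unique zero    = [] ∷ []
allSubsets-unique (suc n) =
  Uniqueₚ.cartesianProductWith⁺ Vec._∷_ Vecₚ.∷-injective (((λ ()) ∷ []) ∷ [] ∷ []) (allSubsets-unique n)

choose-unique : ∀ k (A : Subset n) → Unique (choose k A)
choose-unique k A = Uniqueₚ.filter⁺ (λ B → (B ⊆? A) ×-dec (∣ B ∣ ≟ k)) (allSubsets-unique _)

∈-choose : ∀ {k} {A B : Subset n} → B ⊆ A → ∣ B ∣ ≡ k → B ∈ choose k A
∈-choose {k = k} {A} B⊆A eq = ∈-filter⁺ (λ B → (B ⊆? A) ×-dec (∣ B ∣ ≟ k)) (∈-allSubsets _) (B⊆A , eq)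

-- The algorithm and its specification hand different nonemptiness proofs to `min`; this makes them
-- interchangeable.
min-irrelevant : ∀ (A : Subset n) (p q : Nonempty A) → min A p ≡ min A q
min-irrelevant (inside  Vec.∷ A) _ _ = refl
min-irrelevant (outside Vec.∷ A) (Fin.suc x , Vec.there x∈) (Fin.suc y , Vec.there y∈) =
  cong Fin.suc (min-irrelevant A (x , x∈) (y , y∈))

min-∈ : ∀ (A : Subset n) (p : Nonempty A) → min A p ∈ₛ A
min-∈ (inside  Vec.∷ A) _ = Vec.here
min-∈ (outside Vec.∷ A) (Fin.suc x , Vec.there x∈) = Vec.there (min-∈ A (x , x∈))

-- The runs of `BlockAux` with the forcing rule left out. Peeling columns off `A` follows the
-- recursive calls, and disjointness of the columns is implicit in the index `A ─ B`.
data Split {n} (m : ℕ) : Subset n → List (Subset n) → Set where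
  []  : ∀ {A} → Empty A → Split m A []
  _∷_ : ∀ {A B Cs} → B ⊆ A × ∣ B ∣ ≡ m → Split m (A ─ B) Cs → Split m A (B ∷ Cs)

Split-∣∣ : ∀ {m} {A : Subset n} {Cs} → Split m A Cs → ∣ A ∣ ≡ m * length Cs
Split-∣∣ {n} {m} {A} ([] em) = trans (cong ∣_∣ (Empty-unique em)) (trans (∣⊥∣≡0 n) (sym (*-zeroʳ m)))
Split-∣∣ {m = m} {A} {B ∷ Cs} ((B⊆A , ∣B∣≡m) ∷ s) = begin
  ∣ A ∣               ≡⟨ ∣p─q∣+∣q∣≡∣p∣ A B B⊆A ⟨
  ∣ A ─ B ∣ + ∣ B ∣   ≡⟨ cong₂ _+_ (Split-∣∣ s) ∣B∣≡m ⟩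
  m * length Cs + m   ≡⟨ +-comm _ m ⟩
  m + m * length Cs   ≡⟨ *-suc m (length Cs) ⟨
  m * suc (length Cs) ∎
  where open ≡-Reasoning

Split-sizes : ∀ {m} {A : Subset n} {Cs} → Split m A Cs → All (λ C → ∣ C ∣ ≡ m) Cs
Split-sizes ([] _)            = []
Split-sizes ((_ , eq) ∷ s) = eq ∷ Split-sizes s

Split-⊆ : ∀ {m} {A : Subset n} {Cs x} → Split m A Cs → Any (x ∈ₛ_) Cs → x ∈ₛ A
Split-⊆ ((B⊆A , _) ∷ s) (here x∈)  = B⊆A x∈
Split-⊆ {A = A} {B ∷ _} (_ ∷ s) (there x∈) = p─q⊆p A B (Split-⊆ s x∈)

Split-⊇ : ∀ {m} {A : Subset n} {Cs x} → Split m A Cs → x ∈ₛ A → Any (x ∈ₛ_) Cs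
Split-⊇ ([] em) x∈ = contradiction (_ , x∈) em
Split-⊇ {Cs = B ∷ _} {x} (_ ∷ s) x∈ with x ∈? B
... | yes x∈B = here x∈B
... | no  x∉B = there (Split-⊇ s (x∈p∧x∉q⇒x∈p─q x∈ x∉B))

Split-head : ∀ {m} .{{_ : NonZero m}} {A B : Subset n} {Cs} → Split m A (B ∷ Cs) → Nonempty B
Split-head {B = B} ((_ , eq) ∷ _) = ∣∣-nonempty B eq

-- Each column is recovered from the positions of its elements. As `m` is nonzero no column is
-- empty, so one list cannot be longer than the other without an element to witness it.
Split-⊆-≡ : ∀ {m} .{{_ : NonZero m}} {A A′ : Subset n} {Cs Ds} → Split m A Cs → Split m A′ Ds →
  (∀ {x ℓ} → Nth (x ∈ₛ_) Cs ℓ → Nth (x ∈ₛ_) Ds ℓ) →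
  (∀ {x ℓ} → Nth (x ∈ₛ_) Ds ℓ → Nth (x ∈ₛ_) Cs ℓ) → Cs ≡ Ds
Split-⊆-≡ ([] _)      ([] _)      _ _ = refl
Split-⊆-≡ ([] _)      t@(_ ∷ _)   _ g with () ← g (here (proj₂ (Split-head t)))
Split-⊆-≡ s@(_ ∷ _)   ([] _)      f _ with () ← f (here (proj₂ (Split-head s)))
Split-⊆-≡ (_ ∷ s) (_ ∷ t) f g =
  cong₂ _∷_ (subset-ext λ x → mk⇔ (λ x∈ → head (f (here x∈))) (λ x∈ → head (g (here x∈))))
            (Split-⊆-≡ s t (tail ∘ f ∘ there) (tail ∘ g ∘ there))
  where
  head : ∀ {x B Bs} → Nth (x ∈ₛ_) (B ∷ Bs) 0 → x ∈ₛ B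
  head (here x∈) = x∈
  tail : ∀ {x B Bs ℓ} → Nth (x ∈ₛ_) (B ∷ Bs) (suc ℓ) → Nth (x ∈ₛ_) Bs ℓ
  tail (there p) = p

-- With r = j ∸ aⱼ + 1, this holds because BlockAux forces minⱼ into the column
-- that it chooses when exactly r columns remain.
Timely : Fin n → ℕ → List (Subset n) → Set
Timely v r Cs = ∃ λ ℓ → Nth (v ∈ₛ_) Cs ℓ × ℓ + r ≤ length Cs

-- The column lists enumerated by `blockAux`

∷ʳ-++-assoc : ∀ (xs : List X) y zs → (xs ∷ʳ y) ++ zs ≡ xs ++ y ∷ zs
∷ʳ-++-assoc xs y zs = Listₚ.++-assoc xs [ y ] zs

next-≡ : ∀ (xs : List X) {y y′ zs zs′} → (xs ∷ʳ y) ++ zs ≡ (xs ∷ʳ y′) ++ zs′ → y ≡ y′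
next-≡ xs {y} {y′} {zs} {zs′} eq = Listₚ.∷-injectiveˡ (Listₚ.++-cancelˡ xs _ _
  (trans (sym (∷ʳ-++-assoc xs y zs)) (trans eq (∷ʳ-++-assoc xs y′ zs′))))

module _ (A : Subset n) (v : Fin n) where

  x∈p-y⇒x≢y : ∀ {x} → x ∈ₛ A - v → x ≢ v
  x∈p-y⇒x≢y x∈ refl = x∈p─q⇒x∉q A ⁅ v ⁆ x∈ (x∈⁅x⁆ v)

  p-x∪⁅x⁆≡p : v ∈ₛ A → (A - v) ∪ ⁅ v ⁆ ≡ A
  p-x∪⁅x⁆≡p v∈A = subset-ext λ x → mk⇔ fwd bwd
    where
    fwd : ∀ {x} → x ∈ₛ (A - v) ∪ ⁅ v ⁆ → x ∈ₛ A
    fwd x∈ with x∈p∪q⁻ (A - v) ⁅ v ⁆ x∈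
    ... | inj₁ x∈A-v = p─q⊆p A ⁅ v ⁆ x∈A-v
    ... | inj₂ x∈v   = x∈p⇒⁅x⁆⊆p v∈A x∈v
    bwd : ∀ {x} → x ∈ₛ A → x ∈ₛ (A - v) ∪ ⁅ v ⁆
    bwd {x} x∈A with x Finₚ.≟ v
    ... | yes refl = x∈p∪q⁺ (inj₂ (x∈⁅x⁆ x))
    ... | no  x≢v  = x∈p∪q⁺ (inj₁ (x∈p∧x≢y⇒x∈p-y x∈A x≢v))

  p∪⁅x⁆-x≡p : v ∉ₛ A → (A ∪ ⁅ v ⁆) - v ≡ A
  p∪⁅x⁆-x≡p v∉A = subset-ext λ x → mk⇔ fwd bwd
    where
    fwd : ∀ {x} → x ∈ₛ (A ∪ ⁅ v ⁆) - v → x ∈ₛ A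
    fwd x∈ with x∈p∪q⁻ A ⁅ v ⁆ (p─q⊆p (A ∪ ⁅ v ⁆) ⁅ v ⁆ x∈)
    ... | inj₁ x∈A = x∈A
    ... | inj₂ x∈v = contradiction x∈v (x∈p─q⇒x∉q (A ∪ ⁅ v ⁆) ⁅ v ⁆ x∈)
    bwd : ∀ {x} → x ∈ₛ A → x ∈ₛ (A ∪ ⁅ v ⁆) - v
    bwd {x} x∈A = x∈p∧x≢y⇒x∈p-y (x∈p∪q⁺ (inj₁ x∈A)) λ { refl → v∉A x∈A }

module _ (j m : ℕ) .{{_ : NonZero m}} (v : Fin n) (a : ℕ) where

  private r = j ∸ a + 1

  add-v : ∀ {A B : Subset n} → v ∈ₛ A → B ∈ choose (m ∸ 1) (A - v) →
          B ∪ ⁅ v ⁆ ⊆ A × ∣ B ∪ ⁅ v ⁆ ∣ ≡ m × v ∉ₛ B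
  add-v {A} {B} v∈A B∈ = sub , size , v∉B
    where
    B⊆ = proj₁ (choose-sound (m ∸ 1) (A - v) B∈)
    ∣B∣ = proj₂ (choose-sound (m ∸ 1) (A - v) B∈)
    v∉B : v ∉ₛ B
    v∉B v∈B = x∈p-y⇒x≢y A v (B⊆ v∈B) refl
    sub : B ∪ ⁅ v ⁆ ⊆ A
    sub x∈ with x∈p∪q⁻ B ⁅ v ⁆ x∈
    ... | inj₁ x∈B = p─q⊆p A ⁅ v ⁆ (B⊆ x∈B)
    ... | inj₂ x∈v = x∈p⇒⁅x⁆⊆p v∈A x∈v
    open ≡-Reasoning
    size : ∣ B ∪ ⁅ v ⁆ ∣ ≡ m
    size = begin
      ∣ B ∪ ⁅ v ⁆ ∣           ≡⟨ ∣p-x∣+1≡∣p∣ (B ∪ ⁅ v ⁆) (x∈p∪q⁺ (inj₂ (x∈⁅x⁆ v))) ⟨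
      ∣ (B ∪ ⁅ v ⁆) - v ∣ + 1 ≡⟨ cong (λ C → ∣ C ∣ + 1) (p∪⁅x⁆-x≡p B v v∉B) ⟩
      ∣ B ∣ + 1               ≡⟨ cong (_+ 1) ∣B∣ ⟩
      m ∸ 1 + 1               ≡⟨ m∸n+n≡m (>-nonZero⁻¹ m) ⟩
      m                       ∎

  -- The premise `r ≤ length Ds` says that the forced branch has not been missed yet. While `v` is
  -- unplaced the number of remaining columns falls by one per call, so it must hit `r`, where the
  -- size test succeeds.
  blockAux-sound : ∀ (A : Subset n) ac Cs {C} → C ∈ blockAux j m v a A ac Cs →
    ∃ λ Ds → C ≡ Cs ++ Ds × Split m A Ds × (v ∈ₛ A → r ≤ length Ds → Timely v r Ds)
  blockAux-sound A (acc rec) Cs C∈ with nonempty? A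
  ... | no em with here refl ← C∈ =
    [] , sym (Listₚ.++-identityʳ Cs) , [] em , λ v∈A → contradiction (_ , v∈A) em
  ... | yes _ with (∣ A ∣ ≟ m * r) ×-dec (v ∈? A)
  ...   | yes (∣A∣≡ , v∈A)
          with B , B∈ , C∈B ← find (∈-concatMap⁻ _ {xs = choose (m ∸ 1) (A - v)} C∈)
          with Ds , eq , s , t ← blockAux-sound (A ─ (B ∪ ⁅ v ⁆)) (rec _) (Cs ∷ʳ (B ∪ ⁅ v ⁆)) C∈B
          with sub , size , _ ← add-v v∈A B∈ =
    B ∪ ⁅ v ⁆ ∷ Ds , trans eq (∷ʳ-++-assoc Cs _ Ds) , split ,
    λ _ _ → 0 , here (x∈p∪q⁺ (inj₂ (x∈⁅x⁆ v))) ,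
            ≤-reflexive (*-cancelˡ-≡ r _ m (trans (sym ∣A∣≡) (Split-∣∣ split)))
    where split = ((λ {x} → sub {x}) , size) ∷ s
  blockAux-sound A (acc rec) Cs C∈ | yes _ | no ¬forced
          with B , B∈ , C∈B ← ∈-concat-mapWith∈⁻ _ C∈
          with Ds , eq , s , t ← blockAux-sound (A ─ B) (rec _) (Cs ∷ʳ B) C∈B =
    B ∷ Ds , trans eq (∷ʳ-++-assoc Cs B Ds) , split , timely
    where
    split = choose-sound m A B∈ ∷ s
    timely : v ∈ₛ A → r ≤ suc (length Ds) → Timely v r (B ∷ Ds)
    timely v∈A r≤ with v ∈? B
    ... | yes v∈B = 0 , here v∈B , r≤
    ... | no  v∉B with m≤n⇒m<n∨m≡n r≤
    -- With exactly `r` columns left and `v` among the elements, the forced branch would have been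
    -- taken.
    ...   | inj₂ r≡ = contradiction (trans (Split-∣∣ split) (cong (m *_) (sym r≡)) , v∈A) ¬forced
    ...   | inj₁ (s≤s r≤′) with ℓ , p , ℓ≤ ← t (x∈p∧x∉q⇒x∈p─q v∈A v∉B) r≤′ =
      suc ℓ , there p , s≤s ℓ≤

  -- `Timely` is asked for only while `v` is in `A`: after `v` has been placed the forced branch
  -- cannot apply, and any splitting of the rest is reached.
  blockAux-complete : ∀ (A : Subset n) ac Cs {Ds} → Split m A Ds → (v ∈ₛ A → Timely v r Ds) →
    Cs ++ Ds ∈ blockAux j m v a A ac Cs
  blockAux-complete A (acc rec) Cs s t with nonempty? A | s
  ... | no em | [] _ = here (Listₚ.++-identityʳ Cs)
  ... | no em | s′@((B⊆A , _) ∷ _) = contradiction (_ , B⊆A (proj₂ (Split-head s′))) em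
  ... | yes ne | [] em = contradiction ne em
  ... | yes _ | _∷_ {B = B} {Ds} (B⊆A , ∣B∣) s′ with (∣ A ∣ ≟ m * r) ×-dec (v ∈? A)
  ...   | no _ =
    ∈-concat-mapWith∈⁺ _ (∈-choose B⊆A ∣B∣)
      (subst (_∈ _) (∷ʳ-++-assoc Cs B Ds) (blockAux-complete (A ─ B) (rec _) (Cs ∷ʳ B) s′ later))
    where
    later : v ∈ₛ A ─ B → Timely v r Ds
    later v∈ with t (p─q⊆p A B v∈)
    ... | zero  , here v∈B , _ = contradiction v∈B (x∈p─q⇒x∉q A B v∈)
    ... | suc ℓ , there p , s≤s ℓ≤ = ℓ , p , ℓ≤
  ...   | yes (∣A∣≡ , v∈A) =
    ∈-concatMap⁺ _ (lose B-v∈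
      (subst (_∈ _) (trans (∷ʳ-++-assoc Cs B′ Ds) (cong (λ C → Cs ++ C ∷ Ds) B′≡B))
        (blockAux-complete (A ─ B′) (rec _) (Cs ∷ʳ B′) (subst (λ C → Split m (A ─ C) Ds) (sym B′≡B) s′)
          (λ v∈ → contradiction (x∈p∪q⁺ (inj₂ (x∈⁅x⁆ v))) (x∈p─q⇒x∉q A B′ v∈)))))
    where
    first : ∀ {ℓ} → Nth (v ∈ₛ_) (B ∷ Ds) ℓ → ℓ + r ≤ suc (length Ds) → v ∈ₛ B
    first (here v∈B) _ = v∈B
    -- Exactly `r` columns remain here, so any position but 0 would be too late.
    first {suc ℓ} (there p) ℓ+r≤ = contradiction
      (subst (suc ℓ + r ≤_) (*-cancelˡ-≡ _ r m (trans (sym (Split-∣∣ (((λ {x} → B⊆A {x}) , ∣B∣) ∷ s′))) ∣A∣≡)) ℓ+r≤)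
      (<⇒≱ (s≤s (m≤n+m r ℓ)))
    v∈B : v ∈ₛ B
    v∈B = first (proj₁ (proj₂ (t v∈A))) (proj₂ (proj₂ (t v∈A)))
    -- The forced branch chooses the other elements of the column and then adds `v`, so `B` is
    -- produced in this shape.
    B′ = (B - v) ∪ ⁅ v ⁆
    B′≡B : B′ ≡ B
    B′≡B = p-x∪⁅x⁆≡p B v v∈B
    B-v∈ : B - v ∈ choose (m ∸ 1) (A - v)
    B-v∈ = ∈-choose
      (λ x∈ → x∈p∧x≢y⇒x∈p-y (B⊆A (p─q⊆p B ⁅ v ⁆ x∈)) (x∈p-y⇒x≢y B v x∈))
      (begin
        ∣ B - v ∣         ≡⟨ m+n∸n≡m ∣ B - v ∣ 1 ⟨
        ∣ B - v ∣ + 1 ∸ 1 ≡⟨ cong (_∸ 1) (trans (∣p-x∣+1≡∣p∣ B v∈B) ∣B∣) ⟩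
        m ∸ 1             ∎)
      where open ≡-Reasoning

  -- Different choices of the next column already differ right after the common prefix `Cs`. In the
  -- forced branch this uses that adding `v` is injective on sets without `v`.
  blockAux-unique : ∀ (A : Subset n) ac Cs → Unique (blockAux j m v a A ac Cs)
  blockAux-unique A (acc rec) Cs with nonempty? A
  ... | no _  = [] ∷ []
  ... | yes _ with (∣ A ∣ ≟ m * r) ×-dec (v ∈? A)
  ...   | no _ = AllPairs-concat-mapWith∈ _ (choose-unique m A)
                   (λ {B} _ → blockAux-unique (A ─ B) (rec _) (Cs ∷ʳ B)) λ { {B} {B′} _ _ B≢B′ C∈ C′∈ refl →
    let _ , eq  , _ = blockAux-sound (A ─ B) (rec _) (Cs ∷ʳ B) C∈
        _ , eq′ , _ = blockAux-sound (A ─ B′) (rec _) (Cs ∷ʳ B′) C′∈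
    in B≢B′ (next-≡ Cs (trans (sym eq) eq′)) }
  ...   | yes (_ , v∈A) = AllPairs-concatMap _ (choose-unique (m ∸ 1) (A - v))
                   (λ {B} _ → blockAux-unique (A ─ (B ∪ ⁅ v ⁆)) (rec _) (Cs ∷ʳ (B ∪ ⁅ v ⁆))) λ { {B} {B′} B∈ B′∈ B≢B′ C∈ C′∈ refl →
    let _ , eq  , _ = blockAux-sound (A ─ (B ∪ ⁅ v ⁆)) (rec _) (Cs ∷ʳ (B ∪ ⁅ v ⁆)) C∈
        _ , eq′ , _ = blockAux-sound (A ─ (B′ ∪ ⁅ v ⁆)) (rec _) (Cs ∷ʳ (B′ ∪ ⁅ v ⁆)) C′∈
        _ , _ , v∉B  = add-v v∈A B∈
        _ , _ , v∉B′ = add-v v∈A B′∈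
    in B≢B′ (trans (sym (p∪⁅x⁆-x≡p B v v∉B))
         (trans (cong (_- v) (next-≡ Cs (trans (sym eq) eq′))) (p∪⁅x⁆-x≡p B′ v v∉B′))) }

-- Rows, coordinates and transposition

Unique-resp-↭ : ∀ {xs ys : List X} → xs ↭ ys → Unique xs → Unique ys
Unique-resp-↭ {X} p = ↭ₛ.Unique-resp-↭ (setoid X) (↭⇒↭ₛ p)

-- Keeps the length of the row and the position in it, but not the row itself: exactly the
-- information about `x` that the blocks of φ depend on.
At : List (List X) → X → ℕ → ℕ → Set
At rows x i ℓ = Any (λ r → length r ≡ i × Nth (_≡ x) r ℓ) rows

At⇒∈ : ∀ {rows : List (List X)} {x i ℓ} → At rows x i ℓ → x ∈ concat rows
At⇒∈ at = ∈-concat⁺ (Any.map (Any.map sym ∘ Nth⇒Any ∘ proj₂) at)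

At-++⁻ : ∀ (rows : List (List X)) {rows′ x i ℓ} → At (rows ++ rows′) x i ℓ → At rows x i ℓ ⊎ At rows′ x i ℓ
At-++⁻ rows = Anyₚ.++⁻ rows

zipWith-∷-length : ∀ (xs : List X) yss → length xs ≡ length yss → length (zipWith List._∷_ xs yss) ≡ length yss
zipWith-∷-length xs yss eq = trans (Listₚ.length-zipWith List._∷_ xs yss) (trans (cong (_⊓ length yss) eq) (⊓-idem _))

zipWith-∷-↭ : ∀ (xs : List X) yss → length xs ≡ length yss → concat (zipWith _∷_ xs yss) ↭ xs ++ concat yss
zipWith-∷-↭ []       []         _  = ↭-refl
zipWith-∷-↭ (x ∷ xs) (ys ∷ yss) eq =
  prep x (↭-trans (↭ₚ.++⁺ˡ ys (zipWith-∷-↭ xs yss (suc-injective eq))) (↭ₚ.shifts ys xs))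

zipWith-∷-lengths : ∀ {k} (xs : List X) {yss} → All (λ r → length r ≡ k) yss →
                    All (λ r → length r ≡ suc k) (zipWith _∷_ xs yss)
zipWith-∷-lengths []       _          = []
zipWith-∷-lengths (_ ∷ _)  []         = []
zipWith-∷-lengths (_ ∷ xs) (eq ∷ eqs) = cong suc eq ∷ zipWith-∷-lengths xs eqs

zipWith-∷-here : ∀ {x : X} {xs} yss → length xs ≡ length yss → x ∈ xs →
                 Any (λ r → Nth (_≡ x) r 0) (zipWith _∷_ xs yss)
zipWith-∷-here (_ ∷ _)   _  (here refl) = here (here refl)
zipWith-∷-here (_ ∷ yss) eq (there x∈)  = there (zipWith-∷-here yss (suc-injective eq) x∈)

zipWith-∷-there : ∀ {x : X} {xs yss ℓ} → length xs ≡ length yss → Any (λ r → Nth (_≡ x) r ℓ) yss →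
                  Any (λ r → Nth (_≡ x) r (suc ℓ)) (zipWith _∷_ xs yss)
zipWith-∷-there {xs = _ ∷ _} _  (here p)  = here (there p)
zipWith-∷-there {xs = _ ∷ _} eq (there p) = there (zipWith-∷-there (suc-injective eq) p)

zipWith-∷⁻-zero : ∀ {x : X} xs yss → Any (λ r → Nth (_≡ x) r 0) (zipWith _∷_ xs yss) → x ∈ xs
zipWith-∷⁻-zero (_ ∷ _)  (_ ∷ _)   (here (here refl)) = here refl
zipWith-∷⁻-zero (_ ∷ xs) (_ ∷ yss) (there p) = there (zipWith-∷⁻-zero xs yss p)

zipWith-∷⁻-suc : ∀ {x : X} {ℓ} xs yss → Any (λ r → Nth (_≡ x) r (suc ℓ)) (zipWith _∷_ xs yss) →
                 Any (λ r → Nth (_≡ x) r ℓ) yss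
zipWith-∷⁻-suc (_ ∷ _)  (_ ∷ _)   (here (there p)) = here p
zipWith-∷⁻-suc (_ ∷ xs) (_ ∷ yss) (there p) = there (zipWith-∷⁻-suc xs yss p)

module _ (m : ℕ) where

  -- This is `fromColumns` before `elements` enters. `zipWith` truncates, so entries are preserved
  -- only if every column has height `m`; hence the recurring hypothesis on lengths.
  transpose : List (List X) → List (List X)
  transpose = foldr (zipWith _∷_) (replicate m [])

  transpose-length : ∀ {xss : List (List X)} → All (λ xs → length xs ≡ m) xss → length (transpose xss) ≡ m
  transpose-length []         = Listₚ.length-replicate m
  transpose-length {xss = xs ∷ xss} (eq ∷ eqs) =
    trans (zipWith-∷-length xs (transpose xss) (trans eq (sym (transpose-length eqs)))) (transpose-length eqs)

  transpose-lengths : ∀ (xss : List (List X)) → All (λ r → length r ≡ length xss) (transpose xss)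
  transpose-lengths []         = Allₚ.replicate⁺ m refl
  transpose-lengths (xs ∷ xss) = zipWith-∷-lengths xs (transpose-lengths xss)

  transpose-↭ : ∀ {xss : List (List X)} → All (λ xs → length xs ≡ m) xss → concat (transpose xss) ↭ concat xss
  transpose-↭ [] = ↭-reflexive (concat-replicate m)
    where
    concat-replicate : ∀ k → concat (replicate k []) ≡ []
    concat-replicate zero    = refl
    concat-replicate (suc k) = concat-replicate k
  transpose-↭ {xss = xs ∷ xss} (eq ∷ eqs) =
    ↭-trans (zipWith-∷-↭ xs (transpose xss) (trans eq (sym (transpose-length eqs)))) (↭ₚ.++⁺ˡ xs (transpose-↭ eqs))

  transpose-Nth : ∀ {x : X} {xss} → All (λ xs → length xs ≡ m) xss → ∀ {ℓ} →
                  Nth (x ∈_) xss ℓ ⇔ Any (λ r → Nth (_≡ x) r ℓ) (transpose xss)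
  transpose-Nth {x = x} eqs = mk⇔ (fwd eqs) (bwd _)
    where
    fwd : ∀ {xss ℓ} → All (λ xs → length xs ≡ m) xss → Nth (x ∈_) xss ℓ →
          Any (λ r → Nth (_≡ x) r ℓ) (transpose xss)
    fwd (eq ∷ eqs) (here x∈) = zipWith-∷-here _ (trans eq (sym (transpose-length eqs))) x∈
    fwd (eq ∷ eqs) (there p) = zipWith-∷-there (trans eq (sym (transpose-length eqs))) (fwd eqs p)
    none : ∀ k {ℓ} → ¬ Any (λ r → Nth (_≡ x) r ℓ) (replicate k [])
    none (suc k) (there p) = none k p
    bwd : ∀ xss {ℓ} → Any (λ r → Nth (_≡ x) r ℓ) (transpose xss) → Nth (x ∈_) xss ℓ
    bwd []         p = contradiction p (none m)
    bwd (xs ∷ xss) {zero}  p = here (zipWith-∷⁻-zero xs (transpose xss) p)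
    bwd (xs ∷ xss) {suc ℓ} p = there (bwd xss (zipWith-∷⁻-suc xs (transpose xss) p))

-- Two outputs in one class will only be shown to agree in this sense. Uniqueness therefore needs
-- that different outputs never do, which is stronger than being different as matrices.
Finer SameCoords : List (Matrix n) → List (Matrix n) → Set
Finer M M′ = ∀ {x i ℓ} → At (concat M) x i ℓ → At (concat M′) x i ℓ
SameCoords M M′ = Finer M M′ × Finer M′ M

-- Matrices built from columns, and the fillings they form

module _ (o : FixedOrders n) where
  open FixedOrders o

  ∣∣≡length-elements : ∀ C → ∣ C ∣ ≡ length (elements C)
  ∣∣≡length-elements C = ∣∣≡length (elements-unique C) (elements-∈ C)

  module _ {m : ℕ} {Cs : List (Subset n)} (sizes : All (λ C → ∣ C ∣ ≡ m) Cs) where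

    private
      heights : All (λ xs → length xs ≡ m) (map elements Cs)
      heights = Allₚ.map⁺ (All.map (λ {C} → trans (sym (∣∣≡length-elements C))) sizes)

    At-fromColumns : ∀ {x i ℓ} → At (fromColumns o m Cs) x i ℓ ⇔ (i ≡ length Cs × Nth (x ∈ₛ_) Cs ℓ)
    At-fromColumns {x} {i} {ℓ} = mk⇔ fwd bwd
      where
      rows = transpose-lengths m (map elements Cs)
      len = Listₚ.length-map elements Cs
      fwd : At (fromColumns o m Cs) x i ℓ → i ≡ length Cs × Nth (x ∈ₛ_) Cs ℓ
      fwd at with r , r∈ , refl , _ ← find at =
        trans (All.lookup rows r∈) len ,
        Nth-map (λ {C} → to (elements-∈ C x)) (Nth-map⁻ (from (transpose-Nth m heights) (Any.map proj₂ at)))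
      bwd : i ≡ length Cs × Nth (x ∈ₛ_) Cs ℓ → At (fromColumns o m Cs) x i ℓ
      bwd (refl , p) with r , r∈ , q ← find (to (transpose-Nth m heights)
          (Nth-map⁺ (Nth-map (λ {C} → from (elements-∈ C x)) p))) =
        lose r∈ (trans (All.lookup rows r∈) len , q)

    fromColumns-↭ : concat (fromColumns o m Cs) ↭ concat (map elements Cs)
    fromColumns-↭ = transpose-↭ m heights

    ∈-fromColumns : ∀ {A} → Split m A Cs → ∀ x → x ∈ concat (fromColumns o m Cs) ⇔ x ∈ₛ A
    ∈-fromColumns s x = mk⇔
      (λ x∈ → Split-⊆ s (Any.map (λ {C} → to (elements-∈ C x))
                (Anyₚ.map⁻ (∈-concat⁻ (map elements Cs) (↭ₚ.∈-resp-↭ fromColumns-↭ x∈)))))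
      (λ x∈ → ↭ₚ.∈-resp-↭ (↭-sym fromColumns-↭) (∈-concat⁺ (Anyₚ.map⁺
                (Any.map (λ {C} → from (elements-∈ C x)) (Split-⊇ s x∈)))))

  elements-concat-unique : ∀ {m A Cs} → Split m A Cs → Unique (concat (map elements Cs))
  elements-concat-unique ([] _) = []
  elements-concat-unique {A = A} {B ∷ Cs} (_ ∷ s) = Uniqueₚ.++⁺ (elements-unique B) (elements-concat-unique s)
    λ { {x} (x∈B , x∈Cs) → x∈p─q⇒x∉q A B
        (Split-⊆ s (Any.map (λ {C} → to (elements-∈ C x)) (Anyₚ.map⁻ (∈-concat⁻ (map elements Cs) x∈Cs))))
        (to (elements-∈ B x) x∈B) }

  ∈-unused : ∀ Ms x → x ∈ₛ unused o Ms ⇔ x ∉ concat (concat Ms)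
  ∈-unused Ms x = mk⇔
    (λ x∈ x∈Ms → x∈∁p⇒x∉p x∈ (∈-⋃⁺ (Anyₚ.map⁺ (Any.map (λ { refl → x∈⁅x⁆ x }) x∈Ms))))
    (λ x∉ → x∉p⇒x∈∁p λ x∈ → x∉ (Any.map (x∈⁅y⁆⇒x≡y _) (Anyₚ.map⁻ (∈-⋃⁻ _ x∈))))

  concat²-++ : ∀ (Ms Ns : List (Matrix n)) →
               concat (concat (Ms ++ Ns)) ≡ concat (concat Ms) ++ concat (concat Ns)
  concat²-++ Ms Ns = trans (cong concat (sym (Listₚ.concat-++ Ms Ns))) (sym (Listₚ.concat-++ (concat Ms) (concat Ns)))

  unused-∷ʳ : ∀ Ms {Mⱼ A} → (∀ x → x ∈ concat Mⱼ ⇔ x ∈ₛ A) → unused o (Ms ∷ʳ Mⱼ) ≡ unused o Ms ─ A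
  unused-∷ʳ Ms {Mⱼ} {A} h = subset-ext λ x → mk⇔ fwd bwd
    where
    split : concat (concat (Ms ∷ʳ Mⱼ)) ≡ concat (concat Ms) ++ concat Mⱼ
    split = trans (concat²-++ Ms [ Mⱼ ]) (cong (λ z → concat (concat Ms) ++ concat z) (Listₚ.++-identityʳ Mⱼ))
    fwd : ∀ {x} → x ∈ₛ unused o (Ms ∷ʳ Mⱼ) → x ∈ₛ unused o Ms ─ A
    fwd {x} x∈ = x∈p∧x∉q⇒x∈p─q
      (from (∈-unused Ms x) λ x∈Ms → x∉ (∈-++⁺ˡ x∈Ms))
      (λ x∈A → x∉ (∈-++⁺ʳ (concat (concat Ms)) (from (h x) x∈A)))
      where x∉ = subst (x ∉_) split (to (∈-unused (Ms ∷ʳ Mⱼ) x) x∈)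
    bwd : ∀ {x} → x ∈ₛ unused o Ms ─ A → x ∈ₛ unused o (Ms ∷ʳ Mⱼ)
    bwd {x} x∈ = from (∈-unused (Ms ∷ʳ Mⱼ) x) (subst (x ∉_) (sym split) λ x∈′ →
      case ∈-++⁻ (concat (concat Ms)) x∈′ of λ
        { (inj₁ x∈Ms) → to (∈-unused Ms x) (p─q⊆p (unused o Ms) A x∈) x∈Ms
        ; (inj₂ x∈Mⱼ) → x∈p─q⇒x∉q (unused o Ms) A x∈ (to (h x) x∈Mⱼ) })

  module _ (p : List ℕ) (a : ℕ → ℕ) where

    -- One level of an output, with the forcing rule already translated into the bound `norm`.
    -- Quantifying `norm` over `ne` avoids fixing a nonemptiness proof.
    record Filled (j : ℕ) (U A : Subset n) (Cs : List (Subset n)) : Set where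
      field
        A⊆U   : A ⊆ U
        ∣A∣   : ∣ A ∣ ≡ j * mult p j
        0<m   : 0 < mult p j
        split : Split (mult p j) A Cs
        norm  : ∀ ne → ∃ λ ℓ → Nth (min A ne ∈ₛ_) Cs ℓ × ℓ < a j

      length-Cs : length Cs ≡ j
      length-Cs = *-cancelˡ-≡ _ j (mult p j) {{>-nonZero 0<m}}
        (trans (sym (Split-∣∣ split)) (trans ∣A∣ (*-comm j _)))

      At-head : ∀ {x i ℓ} → At (fromColumns o (mult p j) Cs) x i ℓ ⇔ (i ≡ j × Nth (x ∈ₛ_) Cs ℓ)
      At-head = mk⇔
        (λ at → let eq , q = to (At-fromColumns (Split-sizes split)) at in trans eq length-Cs , q)
        (λ (eq , q) → from (At-fromColumns (Split-sizes split)) (trans eq (sym length-Cs) , q))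

      ∈-head : ∀ x → x ∈ concat (fromColumns o (mult p j) Cs) ⇔ x ∈ₛ A
      ∈-head = ∈-fromColumns (Split-sizes split) split

    open Filled

    -- The matrices M_j , … , M_d whose entries are drawn from U.
    data Filling : ℕ → Subset n → List (Matrix n) → Set where
      done : ∀ {j U} → maxPart p < j → Filling j U []
      skip : ∀ {j U Ns} → j ≤ maxPart p → mult p j ≡ 0 → Filling (suc j) U Ns → Filling j U ([] ∷ Ns)
      step : ∀ {j U Ns A Cs} → j ≤ maxPart p → Filled j U A Cs → Filling (suc j) (U ─ A) Ns →
             Filling j U (fromColumns o (mult p j) Cs ∷ Ns)

    -- This separates the levels: since later matrices have longer rows, a row of length `j` can
    -- only stem from the matrix of level `j`.
    Filling-At : ∀ {j U Ns x i ℓ} → Filling j U Ns → At (concat Ns) x i ℓ → j ≤ i × x ∈ₛ U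
    Filling-At (skip _ _ F) at = let j< , x∈ = Filling-At F at in <⇒≤ j< , x∈
    Filling-At {U = U} (step {j} {A = A} {Cs = Cs} _ f F) at
      with At-++⁻ (fromColumns o (mult p j) Cs) at
    ... | inj₁ at′ = let i≡j , q = to (At-head f) at′ in ≤-reflexive (sym i≡j) , A⊆U f (Split-⊆ (split f) (Nth⇒Any q))
    ... | inj₂ at′ = let j< , x∈ = Filling-At F at′ in <⇒≤ j< , p─q⊆p U A x∈

    -- What a filling says about one size, freed from the recursion and phrased by `At`, so that it
    -- can be compared with the coordinates of a partitioned order. The cardinality later gives back
    -- the multiplicities.
    Level : List (Matrix n) → ℕ → Set
    Level Ns i = ∃ λ A → (∀ x → x ∈ₛ A ⇔ ∃ (At (concat Ns) x i)) × ∣ A ∣ ≡ i * mult p i ×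
                         (∀ ne → ∃ λ ℓ → At (concat Ns) (min A ne) i ℓ × ℓ < a i)

    empty-level : ∀ {Ns i} → mult p i ≡ 0 → (∀ {x ℓ} → ¬ At (concat Ns) x i ℓ) → Level Ns i
    empty-level {i = i} m≡0 none =
      ∅ , (λ x → mk⇔ (⊥-elim ∘ ∉⊥) (⊥-elim ∘ none ∘ proj₂)) ,
      trans (∣⊥∣≡0 n) (sym (trans (cong (i *_) m≡0) (*-zeroʳ i))) , λ (_ , x∈) → contradiction x∈ ∉⊥

    mult-max : ∀ {i} → maxPart p < i → mult p i ≡ 0
    mult-max {i} max<i = cong length (Listₚ.filter-none (i ≟_) (All.map
      (λ x≤max i≡x → <⇒≱ max<i (subst (_≤ maxPart p) (sym i≡x) x≤max)) (Extrema.xs≤max 0 p)))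

    Filling-Level : ∀ {j U Ns i} → Filling j U Ns → j ≤ i → Level Ns i
    Filling-Level (done max<j) j≤i = empty-level {Ns = []} (mult-max (<-≤-trans max<j j≤i)) λ ()
    Filling-Level {Ns = _ ∷ Ns} (skip _ m≡0 F) j≤i with m≤n⇒m<n∨m≡n j≤i
    ... | inj₁ j<i  = Filling-Level F j<i
    ... | inj₂ refl = empty-level {Ns = Ns} m≡0 λ at → <-irrefl refl (proj₁ (Filling-At F at))
    Filling-Level {i = i} (step {j} {Ns = Ns} {A} {Cs} _ f F) j≤i with m≤n⇒m<n∨m≡n j≤i
    ... | inj₂ refl = A ,
      (λ x → mk⇔
        (λ x∈ → let ℓ , q = Any⇒Nth (Split-⊇ (split f) x∈) in ℓ , head⁺ q)
        (λ (ℓ , at) → Split-⊆ (split f) (Nth⇒Any (head⁻ at)))) ,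
      ∣A∣ f ,
      λ ne → let ℓ , q , ℓ< = norm f ne in ℓ , head⁺ q , ℓ<
      where
      head⁺ : ∀ {x ℓ} → Nth (x ∈ₛ_) Cs ℓ → At (fromColumns o (mult p j) Cs ++ concat Ns) x j ℓ
      head⁺ q = Anyₚ.++⁺ˡ (from (At-head f) (refl , q))
      head⁻ : ∀ {x ℓ} → At (fromColumns o (mult p j) Cs ++ concat Ns) x j ℓ → Nth (x ∈ₛ_) Cs ℓ
      head⁻ at with At-++⁻ (fromColumns o (mult p j) Cs) at
      ... | inj₁ at′ = proj₂ (to (At-head f) at′)
      ... | inj₂ at′ = contradiction (proj₁ (Filling-At F at′)) (<-irrefl refl)
    ... | inj₁ j<i =
      let A , h , eq , nm = Filling-Level F j<i
      in A , (λ x → mk⇔ (λ x∈ → let ℓ , at = to (h x) x∈ in ℓ , Anyₚ.++⁺ʳ (fromColumns o (mult p j) Cs) at)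
                        (λ (ℓ , at) → from (h x) (ℓ , rest at))) , eq ,
         λ ne → let ℓ , at , ℓ< = nm ne in ℓ , Anyₚ.++⁺ʳ (fromColumns o (mult p j) Cs) at , ℓ<
      where
      rest : ∀ {x ℓ} → At (fromColumns o (mult p j) Cs ++ concat Ns) x i ℓ → At (concat Ns) x i ℓ
      rest at with At-++⁻ (fromColumns o (mult p j) Cs) at
      ... | inj₁ at′ = contradiction (sym (proj₁ (to (At-head f) at′))) (<⇒≢ j<i)
      ... | inj₂ at′ = at′

    filter-max : ∀ {j} → maxPart p < j → filter (j ≤?_) p ≡ []
    filter-max {j} max<j = Listₚ.filter-none (j ≤?_) (All.map
      (λ x≤max j≤x → <⇒≱ max<j (≤-trans j≤x x≤max)) (Extrema.xs≤max 0 p))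

    -- Advances the invariant of `Filling-entries` by one level: the parts of size at least `j` are
    -- the larger ones together with `mult q j` copies of `j`.
    sum-filter : ∀ q j → sum (filter (j ≤?_) q) ≡ sum (filter (suc j ≤?_) q) + j * mult q j
    sum-filter []      j = sym (*-zeroʳ j)
    sum-filter (x ∷ q) j with <-cmp j x
    ... | tri< j<x j≢x _
      rewrite Listₚ.filter-accept (j ≤?_) {x} {q} (<⇒≤ j<x)
            | Listₚ.filter-accept (suc j ≤?_) {x} {q} j<x
            | Listₚ.filter-reject (j ≟_) {x} {q} j≢x =
      trans (cong (x +_) (sum-filter q j)) (sym (+-assoc x _ _))
    ... | tri≈ j≮x refl _
      rewrite Listₚ.filter-accept (j ≤?_) {j} {q} ≤-refl
            | Listₚ.filter-reject (suc j ≤?_) {j} {q} j≮x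
            | Listₚ.filter-accept (j ≟_) {j} {q} refl
            | *-suc j (mult q j) =
      trans (cong (j +_) (sum-filter q j)) (trans (sym (+-assoc j S _)) (trans (cong (_+ j * mult q j) (+-comm j S)) (+-assoc S j _)))
      where S = sum (filter (suc j ≤?_) q)
    ... | tri> j≮x j≢x x<j
      rewrite Listₚ.filter-reject (j ≤?_) {x} {q} (<⇒≱ x<j)
            | Listₚ.filter-reject (suc j ≤?_) {x} {q} j≮x
            | Listₚ.filter-reject (j ≟_) {x} {q} j≢x = sum-filter q j

    -- The invariant is that `U` has as many elements as the remaining parts need. Beyond the
    -- largest part that number is 0, so nothing is left over and every element has been placed.
    Filling-entries : ∀ {j U Ns} → Filling j U Ns → 0 < j → ∣ U ∣ ≡ sum (filter (j ≤?_) p) →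
      Unique (concat (concat Ns)) × (∀ x → x ∈ concat (concat Ns) ⇔ x ∈ₛ U) ×
      All (λ r → 0 < length r) (concat Ns)
    Filling-entries {U = U} (done max<j) _ eq =
      [] , (λ x → mk⇔ (λ ()) λ x∈ → contradiction (x , x∈)
             (∣∣≡0⇒Empty U (trans eq (cong sum (filter-max max<j))))) , []
    Filling-entries {j} {U} (skip _ m≡0 F) _ eq = Filling-entries F z<s (begin
      ∣ U ∣                                          ≡⟨ eq ⟩
      sum (filter (j ≤?_) p)                         ≡⟨ sum-filter p j ⟩
      sum (filter (suc j ≤?_) p) + j * mult p j      ≡⟨ cong (λ m → sum (filter (suc j ≤?_) p) + j * m) m≡0 ⟩
      sum (filter (suc j ≤?_) p) + j * 0             ≡⟨ cong (sum (filter (suc j ≤?_) p) +_) (*-zeroʳ j) ⟩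
      sum (filter (suc j ≤?_) p) + 0                 ≡⟨ +-identityʳ _ ⟩
      sum (filter (suc j ≤?_) p)                     ∎)
      where open ≡-Reasoning
    Filling-entries {j} {U} (step {Ns = Ns} {A} {Cs} _ f F) 0<j eq =
      let u , h , pos = Filling-entries F z<s (+-cancelʳ-≡ (∣ A ∣) _ _ (begin
            ∣ U ─ A ∣ + ∣ A ∣                         ≡⟨ ∣p─q∣+∣q∣≡∣p∣ U A (A⊆U f) ⟩
            ∣ U ∣                                     ≡⟨ eq ⟩
            sum (filter (j ≤?_) p)                    ≡⟨ sum-filter p j ⟩
            sum (filter (suc j ≤?_) p) + j * mult p j ≡⟨ cong (sum (filter (suc j ≤?_) p) +_) (∣A∣ f) ⟨
            sum (filter (suc j ≤?_) p) + ∣ A ∣        ∎))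
          fwd : ∀ x → x ∈ concat Mⱼ ++ concat (concat Ns) → x ∈ₛ U
          fwd x x∈ = case ∈-++⁻ (concat Mⱼ) x∈ of λ
            { (inj₁ x∈Mⱼ) → A⊆U f (to (∈-head f x) x∈Mⱼ)
            ; (inj₂ x∈Ns) → p─q⊆p U A (to (h x) x∈Ns) }
          bwd : ∀ x → x ∈ₛ U → x ∈ concat Mⱼ ++ concat (concat Ns)
          bwd x x∈U = case x ∈? A of λ
            { (yes x∈A) → ∈-++⁺ˡ (from (∈-head f x) x∈A)
            ; (no  x∉A) → ∈-++⁺ʳ (concat Mⱼ) (from (h x) (x∈p∧x∉q⇒x∈p─q x∈U x∉A)) }
      in subst (λ xs → Unique xs × (∀ x → x ∈ xs ⇔ x ∈ₛ U) × All (λ r → 0 < length r) (Mⱼ ++ concat Ns))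
           (Listₚ.concat-++ Mⱼ (concat Ns))
           ( Uniqueₚ.++⁺ Mⱼ! u (λ { {x} (x∈Mⱼ , x∈Ns) →
               x∈p─q⇒x∉q U A (to (h x) x∈Ns) (to (∈-head f x) x∈Mⱼ) })
           , (λ x → mk⇔ (fwd x) (bwd x))
           , Allₚ.++⁺ (All.map (λ eq → subst (0 <_) (sym (trans eq (trans (Listₚ.length-map elements Cs) (length-Cs f)))) 0<j)
                        (transpose-lengths (mult p j) (map elements Cs))) pos )
      where
      open ≡-Reasoning
      Mⱼ = fromColumns o (mult p j) Cs
      Mⱼ! : Unique (concat Mⱼ)
      Mⱼ! = Unique-resp-↭ (↭-sym (fromColumns-↭ (Split-sizes (split f)))) (elements-concat-unique (split f))

-- Soundness, completeness and distinctness of `aux`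

j∸a+1≤j : ∀ {a j} → 0 < a → a ≤ j → j ∸ a + 1 ≤ j
j∸a+1≤j {a} {j} 0<a a≤j = begin
  j ∸ a + 1 ≤⟨ +-monoʳ-≤ (j ∸ a) 0<a ⟩
  j ∸ a + a ≡⟨ m∸n+n≡m a≤j ⟩
  j         ∎
  where open ≤-Reasoning

ℓ+[j∸a+1]≡ : ∀ ℓ j a → ℓ + (j ∸ a + 1) ≡ suc ℓ + (j ∸ a)
ℓ+[j∸a+1]≡ ℓ j a = trans (cong (ℓ +_) (+-comm (j ∸ a) 1)) (+-suc ℓ (j ∸ a))

-- Cancel j - a on both sides; `a ≤ j` makes the truncated subtraction a genuine one. Together with
-- the converse below, this identifies the forcing rule with the bound on the minimum.
timely⇒early : ∀ {ℓ j a} → a ≤ j → ℓ + (j ∸ a + 1) ≤ j → ℓ < a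
timely⇒early {ℓ} {j} {a} a≤j h = +-cancelʳ-≤ (j ∸ a) (suc ℓ) a
  (subst₂ _≤_ (ℓ+[j∸a+1]≡ ℓ j a) (sym (m+[n∸m]≡n a≤j)) h)

early⇒timely : ∀ {ℓ j a} → a ≤ j → ℓ < a → ℓ + (j ∸ a + 1) ≤ j
early⇒timely {ℓ} {j} {a} a≤j ℓ<a =
  subst₂ _≤_ (sym (ℓ+[j∸a+1]≡ ℓ j a)) (m+[n∸m]≡n a≤j) (+-monoˡ-≤ (j ∸ a) ℓ<a)

module _ (o : FixedOrders n) (p : List ℕ) (a : ℕ → ℕ)
         (bounded : ∀ {j} → 0 < mult p j → 0 < a j × a j ≤ j) where

  filled : ∀ {j U A ne ac Cs} (0<m : 0 < mult p j) → A ∈ choose (j * mult p j) U →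
           Cs ∈ blockAux j (mult p j) {{>-nonZero 0<m}} (min A ne) (a j) A ac [] → Filled o p a j U A Cs
  filled {j} {U} {A} {ne} {ac} {Cs} 0<m A∈ Cs∈
    with Ds , refl , s , t ← blockAux-sound j (mult p j) {{>-nonZero 0<m}} (min A ne) (a j) A ac [] Cs∈ =
    record
    { A⊆U = A⊆U ; ∣A∣ = ∣A∣ ; 0<m = 0<m ; split = s ; norm = norm }
    where
    A⊆U : A ⊆ U
    A⊆U = proj₁ (choose-sound (j * mult p j) U A∈)
    ∣A∣ = proj₂ (choose-sound (j * mult p j) U A∈)
    len : length Cs ≡ j
    len = *-cancelˡ-≡ _ j (mult p j) {{>-nonZero 0<m}} (trans (sym (Split-∣∣ s)) (trans ∣A∣ (*-comm j _)))
    norm : ∀ ne → ∃ λ ℓ → Nth (min A ne ∈ₛ_) Cs ℓ × ℓ < a j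
    norm ne′ rewrite min-irrelevant A ne′ ne =
      let 0<a , a≤j = bounded 0<m
          ℓ , q , ℓ≤ = t (min-∈ A ne) (subst (_ ≤_) (sym len) (j∸a+1≤j 0<a a≤j))
      in ℓ , q , timely⇒early a≤j (subst (ℓ + (j ∸ a j + 1) ≤_) len ℓ≤)

  unused-step : ∀ {j} Ms {A Cs} → Filled o p a j (unused o Ms) A Cs →
                unused o (Ms ∷ʳ fromColumns o (mult p j) Cs) ≡ unused o Ms ─ A
  unused-step Ms f = unused-∷ʳ o Ms (Filled.∈-head f)

  unused-skip : ∀ Ms → unused o (Ms ∷ʳ []) ≡ unused o Ms
  unused-skip Ms = trans (unused-∷ʳ o Ms {A = ∅} λ x → mk⇔ (λ ()) (⊥-elim ∘ ∉⊥)) (p─⊥≡p _)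

  -- Repeats the call made by `aux` through `block`, nonemptiness proof and instances included, so
  -- that the two agree by computation.
  columns : ∀ j .{{_ : NonZero j}} → 0 < mult p j → ∀ U {A} → A ∈ choose (j * mult p j) U → List (List (Subset n))
  columns j 0<m U {A} A∈ = blockAux j (mult p j) (min A (∣∣-nonempty A (proj₂ (choose-sound (j * mult p j) U A∈))))
                                    (a j) A (⊂-wellFounded A) []
    where instance
      m≢0  = >-nonZero 0<m
      jm≢0 = m*n≢0 j (mult p j)

  Suffix : ℕ → List (Matrix n) → List (Matrix n) → Set
  Suffix j Ms M = ∃ λ Ns → M ≡ Ms ++ Ns × Filling o p a j (unused o Ms) Ns

  aux-sound : ∀ j .{{_ : NonZero j}} ac Ms {M} → M ∈ aux o p a j ac Ms → Suffix j Ms M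
  aux-sound j (acc rec) Ms M∈ with maxPart p <? j
  ... | yes max<j with here refl ← M∈ = [] , sym (Listₚ.++-identityʳ Ms) , done max<j
  ... | no  max≮j with 0 <? mult p j
  ...   | yes 0<m
          with A , A∈ , M∈A ← ∈-concat-mapWith∈⁻ _ M∈
          with Mⱼ , Mⱼ∈ , M∈Mⱼ ← find (∈-concatMap⁻ _ {xs = block o A j (mult p j) {{>-nonZero 0<m}} _ _} M∈A)
          with Cs , Cs∈ , refl ← ∈-map⁻ (fromColumns o (mult p j)) Mⱼ∈
          with Ns , eq , F ← aux-sound (suc j) (rec _) (Ms ∷ʳ Mⱼ) M∈Mⱼ =
    Mⱼ ∷ Ns , trans eq (∷ʳ-++-assoc Ms Mⱼ Ns) , step (≮⇒≥ max≮j) f (subst (λ U → Filling o p a (suc j) U Ns) (unused-step Ms f) F)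
    where f = filled 0<m A∈ Cs∈
  aux-sound j (acc rec) Ms M∈ | no max≮j | no m≯0
          with Ns , eq , F ← aux-sound (suc j) (rec _) (Ms ∷ʳ []) M∈ =
    [] ∷ Ns , trans eq (∷ʳ-++-assoc Ms [] Ns) ,
    skip (≮⇒≥ max≮j) (n≤0⇒n≡0 (≮⇒≥ m≯0)) (subst (λ U → Filling o p a (suc j) U Ns) (unused-skip Ms) F)

  aux-complete : ∀ j .{{_ : NonZero j}} ac Ms {Ns} → Filling o p a j (unused o Ms) Ns → Ms ++ Ns ∈ aux o p a j ac Ms
  aux-complete j (acc rec) Ms F with maxPart p <? j | F
  ... | yes _     | done _      = here (Listₚ.++-identityʳ Ms)
  ... | yes max<j | skip j≤ _ _ = contradiction j≤ (<⇒≱ max<j)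
  ... | yes max<j | step j≤ _ _ = contradiction j≤ (<⇒≱ max<j)
  ... | no  max≮j | done max<j  = contradiction max<j max≮j
  ... | no  max≮j | skip {Ns = Ns} _ m≡0 F′ with 0 <? mult p j
  ...   | yes 0<m = contradiction (sym m≡0) (<⇒≢ 0<m)
  ...   | no  _   = subst (_∈ _) (∷ʳ-++-assoc Ms [] Ns)
    (aux-complete (suc j) (rec _) (Ms ∷ʳ []) (subst (λ U → Filling o p a (suc j) U Ns) (sym (unused-skip Ms)) F′))
  aux-complete j (acc rec) Ms F | no max≮j | step {Ns = Ns} {A} {Cs} _ f F′ with 0 <? mult p j
  ...   | no  m≯0 = contradiction (Filled.0<m f) m≯0
  ...   | yes 0<m = ∈-concat-mapWith∈⁺ _ (∈-choose (Filled.A⊆U f) (Filled.∣A∣ f))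
    (∈-concatMap⁺ (λ Mⱼ → aux o p a (suc j) (rec (∸-monoʳ-< ≤-refl (s≤s (≮⇒≥ max≮j)))) (Ms ∷ʳ Mⱼ))
      (lose (∈-map⁺ (fromColumns o (mult p j)) Cs∈)
        (subst (_∈ _) (∷ʳ-++-assoc Ms Mⱼ Ns)
          (aux-complete (suc j) (rec _) (Ms ∷ʳ Mⱼ) (subst (λ U → Filling o p a (suc j) U Ns) (sym (unused-step Ms f)) F′)))))
    where
    Mⱼ = fromColumns o (mult p j) Cs
    Cs∈ : Cs ∈ columns j 0<m (unused o Ms) (∈-choose (Filled.A⊆U f) (Filled.∣A∣ f))
    Cs∈ = blockAux-complete j (mult p j) {{>-nonZero 0<m}} _ (a j) A (⊂-wellFounded A) [] (Filled.split f)
      λ _ → let ℓ , q , ℓ<a = Filled.norm f _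
            in ℓ , q , subst (_ ≤_) (sym (Filled.length-Cs f)) (early⇒timely (proj₂ (bounded 0<m)) ℓ<a)

  -- An output cut at level `j`: the common prefix `Ms`, the matrix chosen at this level, and a
  -- filling of what remains.
  Chunk : ℕ → List (Matrix n) → List (Matrix n) → Subset n → List (Subset n) → Set
  Chunk j Ms M A Cs = ∃ λ Ns → M ≡ Ms ++ fromColumns o (mult p j) Cs ∷ Ns × Filled o p a j (unused o Ms) A Cs ×
                               Filling o p a (suc j) (unused o Ms ─ A) Ns

  Chunk-columns : ∀ {j Ms M M′ A A′ Cs Cs′} → Chunk j Ms M A Cs → Chunk j Ms M′ A′ Cs′ → Finer M M′ →
                  ∀ {x ℓ} → Nth (x ∈ₛ_) Cs ℓ → Nth (x ∈ₛ_) Cs′ ℓ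
  Chunk-columns {j} {Ms} {Cs = Cs} {Cs′} (Ns , refl , f , F) (Ns′ , refl , f′ , F′) finer {x} {ℓ} q =
    locate (finer (subst (λ rows → At rows x j ℓ) (Listₚ.concat-++ Ms (Mⱼ Cs ∷ Ns))
      (Anyₚ.++⁺ʳ (concat Ms) (Anyₚ.++⁺ˡ (from (Filled.At-head f) (refl , q))))))
    where
    Mⱼ = fromColumns o (mult p j)
    locate : At (concat (Ms ++ Mⱼ Cs′ ∷ Ns′)) x j ℓ → Nth (x ∈ₛ_) Cs′ ℓ
    locate at with At-++⁻ (concat Ms) (subst (λ rows → At rows x j ℓ) (sym (Listₚ.concat-++ Ms (Mⱼ Cs′ ∷ Ns′))) at)
    ... | inj₁ at₁ = contradiction (At⇒∈ at₁)
      (to (∈-unused o Ms x) (Filled.A⊆U f (Split-⊆ (Filled.split f) (Nth⇒Any q))))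
    ... | inj₂ at₂ with At-++⁻ (Mⱼ Cs′) at₂
    ...   | inj₁ at₃ = proj₂ (to (Filled.At-head f′) at₃)
    ...   | inj₂ at₃ = contradiction (proj₁ (Filling-At o p a F′ at₃)) (<-irrefl refl)

  Chunk-≡ : ∀ {j Ms M M′ A A′ Cs Cs′} → Chunk j Ms M A Cs → Chunk j Ms M′ A′ Cs′ → SameCoords M M′ →
            A ≡ A′ × Cs ≡ Cs′
  Chunk-≡ {j} c@(_ , _ , f , _) c′@(_ , _ , f′ , _) (finer , finer′) =
    (subset-ext λ x → mk⇔ (transfer s s′ fwd) (transfer s′ s bwd)) , Split-⊆-≡ {{>-nonZero (Filled.0<m f)}} s s′ fwd bwd
    where
    s = Filled.split f
    s′ = Filled.split f′
    fwd = λ {x} {ℓ} → Chunk-columns c c′ finer {x} {ℓ}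
    bwd = λ {x} {ℓ} → Chunk-columns c′ c finer′ {x} {ℓ}
    transfer : ∀ {m A A′ Cs Cs′ x} → Split m A Cs → Split m A′ Cs′ →
               (∀ {x ℓ} → Nth (x ∈ₛ_) Cs ℓ → Nth (x ∈ₛ_) Cs′ ℓ) → x ∈ₛ A → x ∈ₛ A′
    transfer t t′ h x∈ = Split-⊆ t′ (Nth⇒Any (h (proj₂ (Any⇒Nth (Split-⊇ t x∈)))))

  chunk : ∀ j .{{_ : NonZero j}} (0<m : 0 < mult p j) Ms ac {A} (A∈ : A ∈ choose (j * mult p j) (unused o Ms)) {Cs M} →
          Cs ∈ columns j 0<m (unused o Ms) A∈ → M ∈ aux o p a (suc j) ac (Ms ∷ʳ fromColumns o (mult p j) Cs) →
          Chunk j Ms M A Cs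
  chunk j 0<m Ms ac A∈ {Cs} Cs∈ M∈ =
    let Ns , eq , F = aux-sound (suc j) ac (Ms ∷ʳ fromColumns o (mult p j) Cs) M∈
        f = filled 0<m A∈ Cs∈
    in Ns , trans eq (∷ʳ-++-assoc Ms _ Ns) , f , subst (λ U → Filling o p a (suc j) U Ns) (unused-step Ms f) F

  chunk-of : ∀ j .{{_ : NonZero j}} (0<m : 0 < mult p j) Ms ac {A} (A∈ : A ∈ choose (j * mult p j) (unused o Ms)) {M} →
             M ∈ concatMap (λ Mⱼ → aux o p a (suc j) ac (Ms ∷ʳ Mⱼ))
                   (map (fromColumns o (mult p j)) (columns j 0<m (unused o Ms) A∈)) →
             ∃ (Chunk j Ms M A)
  chunk-of j 0<m Ms ac A∈ M∈
    with Mⱼ , Mⱼ∈ , M∈Mⱼ ← find (∈-concatMap⁻ _ {xs = map (fromColumns o (mult p j)) (columns j 0<m _ A∈)} M∈)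
    with Cs , Cs∈ , refl ← ∈-map⁻ (fromColumns o (mult p j)) Mⱼ∈ = Cs , chunk j 0<m Ms ac A∈ Cs∈ M∈Mⱼ

  -- At the first level where two runs diverge they choose a different `A` or different columns, and
  -- `Chunk-≡` recovers both from the coordinates.
  aux-distinct : ∀ j .{{_ : NonZero j}} ac Ms → AllPairs (λ M M′ → ¬ SameCoords M M′) (aux o p a j ac Ms)
  aux-distinct j (acc rec) Ms with maxPart p <? j
  ... | yes _ = [] ∷ []
  ... | no  max≮j with 0 <? mult p j
  ...   | no  _   = aux-distinct (suc j) (rec _) (Ms ∷ʳ [])
  ...   | yes 0<m =
    AllPairs-concat-mapWith∈ _ (choose-unique (j * mult p j) (unused o Ms))
      -- Fusing the two maps lets the loop range over column lists, whose distinctness is known,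
      -- instead of over matrices.
      (λ {A} A∈ → subst (AllPairs _) (sym (Listₚ.concatMap-map next (fromColumns o (mult p j)) (columns j 0<m _ A∈)))
        (AllPairs-concatMap (next ∘ fromColumns o (mult p j))
          (blockAux-unique j (mult p j) {{>-nonZero 0<m}} _ (a j) A (⊂-wellFounded A) [])
          (λ {Cs} _ → aux-distinct (suc j) (rec _) (Ms ∷ʳ fromColumns o (mult p j) Cs))
          λ Cs∈ Cs′∈ Cs≢Cs′ M∈ M′∈ same → Cs≢Cs′ (proj₂ (Chunk-≡
            (chunk j 0<m Ms (rec _) A∈ Cs∈ M∈) (chunk j 0<m Ms (rec _) A∈ Cs′∈ M′∈) same))))
      λ A∈ A′∈ A≢A′ M∈ M′∈ same → A≢A′ (proj₁ (Chunk-≡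
        (proj₂ (chunk-of j 0<m Ms (rec _) A∈ M∈)) (proj₂ (chunk-of j 0<m Ms (rec _) A′∈ M′∈)) same))
    where
    next = λ Mⱼ → aux o p a (suc j) (rec (∸-monoʳ-< ≤-refl (s≤s (≮⇒≥ max≮j)))) (Ms ∷ʳ Mⱼ)

At-functional : ∀ {rows : List (List X)} {x i i′ ℓ ℓ′} → All Unique rows → AllPairs Disjoint rows →
                At rows x i ℓ → At rows x i′ ℓ′ → i ≡ i′ × ℓ ≡ ℓ′
At-functional (r! ∷ _) _ (here (refl , p)) (here (refl , q)) = refl , Nth-injective r! p q
At-functional (_ ∷ rs!) (_ ∷ ds) (there p) (there q) = At-functional rs! ds p q
At-functional _ (d ∷ _) (here (_ , p)) (there q) with r , r∈ , _ , q′ ← find q =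
  contradiction (Any.map sym (Nth⇒Any p) , Any.map sym (Nth⇒Any q′)) (All.lookup d r∈)
At-functional _ (d ∷ _) (there q) (here (_ , p)) with r , r∈ , _ , q′ ← find q =
  contradiction (Any.map sym (Nth⇒Any p) , Any.map sym (Nth⇒Any q′)) (All.lookup d r∈)

-- Congruences of natural numbers

%-congˡ-+ : ∀ t u i s .{{_ : NonZero s}} → t % s ≡ u % s → (t + i) % s ≡ (u + i) % s
%-congˡ-+ t u i s eq = begin
  (t + i) % s             ≡⟨ %-distribˡ-+ t i s ⟩
  (t % s + i % s) % s     ≡⟨ cong (λ z → (z + i % s) % s) eq ⟩
  (u % s + i % s) % s     ≡⟨ %-distribˡ-+ u i s ⟨
  (u + i) % s             ∎
  where open ≡-Reasoning

-- Adding `i * s′`, where `s′` is s - 1, turns the summand `i` into the multiple `i * s`, which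
-- vanishes modulo `s`.
%-cancelʳ-+ : ∀ t u i s .{{_ : NonZero s}} → (t + i) % s ≡ (u + i) % s → t % s ≡ u % s
%-cancelʳ-+ t u i s@(suc s′) eq = begin
  t % s                    ≡⟨ expand t ⟩
  (t + i + i * s′) % s     ≡⟨ %-congˡ-+ (t + i) (u + i) (i * s′) s eq ⟩
  (u + i + i * s′) % s     ≡⟨ expand u ⟨
  u % s                    ∎
  where
  open ≡-Reasoning
  expand : ∀ t → t % s ≡ (t + i + i * s′) % s
  expand t = begin
    t % s                ≡⟨ [m+kn]%n≡m%n t i s ⟨
    (t + i * s) % s      ≡⟨ cong (λ z → (t + z) % s) (*-suc i s′) ⟩
    (t + (i + i * s′)) % s ≡⟨ cong (_% s) (+-assoc t i _) ⟨
    (t + i + i * s′) % s ∎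

%-shift-∣ : ∀ t d s .{{_ : NonZero s}} → (d + t) % s ≡ t % s → s ∣ d
%-shift-∣ t d s h = m%n≡0⇒n∣m d s (trans (%-cancelʳ-+ d 0 t s h) (m<n⇒m%n≡m (>-nonZero⁻¹ s)))

%-∣ : ∀ {t u s L} .{{_ : NonZero s}} .{{_ : NonZero L}} → s ∣ L → t % L ≡ u % L → t % s ≡ u % s
%-∣ {t} {u} {s} {L} s∣L eq = trans (sym (m∣n⇒o%n%m≡o%m s L t s∣L)) (trans (cong (_% s) eq) (m∣n⇒o%n%m≡o%m s L u s∣L))

-- Turns the integer index used by `σ` into a congruence in ℕ. Division gives e + i + q L = k over
-- the integers; if q is negative, its term is moved to the other side so that only naturals occur.
%ℕ-shift : ∀ k i L .{{_ : NonZero L}} → ((ℤ.+ k ℤ.- ℤ.+ i) %ℕ L + i) % L ≡ k % L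
%ℕ-shift k i L = go (z /ℕ L) (begin
  ℤ.+ (e + i) ℤ.+ z /ℕ L ℤ.* ℤ.+ L            ≡⟨ swapped ⟩
  (ℤ.+ e ℤ.+ z /ℕ L ℤ.* ℤ.+ L) ℤ.+ ℤ.+ i     ≡⟨ cong (λ w → w ℤ.+ ℤ.+ i) (a≡a%ℕn+[a/ℕn]*n z L) ⟨
  (ℤ.+ k ℤ.- ℤ.+ i) ℤ.+ ℤ.+ i                 ≡⟨ ℤₚ.+-assoc (ℤ.+ k) (ℤ.- ℤ.+ i) (ℤ.+ i) ⟩
  ℤ.+ k ℤ.+ (ℤ.- ℤ.+ i ℤ.+ ℤ.+ i)             ≡⟨ cong (λ w → ℤ.+ k ℤ.+ w) (ℤₚ.+-inverseˡ (ℤ.+ i)) ⟩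
  ℤ.+ k ℤ.+ ℤ.+ 0                              ≡⟨ ℤₚ.+-identityʳ (ℤ.+ k) ⟩
  ℤ.+ k                                        ∎)
  where
  open ≡-Reasoning
  z = ℤ.+ k ℤ.- ℤ.+ i
  e = z %ℕ L
  swapped : ℤ.+ (e + i) ℤ.+ z /ℕ L ℤ.* ℤ.+ L ≡ (ℤ.+ e ℤ.+ z /ℕ L ℤ.* ℤ.+ L) ℤ.+ ℤ.+ i
  swapped = begin
    ℤ.+ (e + i) ℤ.+ c           ≡⟨ ℤₚ.+-assoc (ℤ.+ e) (ℤ.+ i) c ⟩
    ℤ.+ e ℤ.+ (ℤ.+ i ℤ.+ c)    ≡⟨ cong (λ w → ℤ.+ e ℤ.+ w) (ℤₚ.+-comm (ℤ.+ i) c) ⟩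
    ℤ.+ e ℤ.+ (c ℤ.+ ℤ.+ i)    ≡⟨ ℤₚ.+-assoc (ℤ.+ e) c (ℤ.+ i) ⟨
    (ℤ.+ e ℤ.+ c) ℤ.+ ℤ.+ i    ∎
    where c = z /ℕ L ℤ.* ℤ.+ L
  go : ∀ q → ℤ.+ (e + i) ℤ.+ q ℤ.* ℤ.+ L ≡ ℤ.+ k → (e + i) % L ≡ k % L
  go (ℤ.+ c) eq = trans (sym ([m+kn]%n≡m%n (e + i) c L)) (cong (_% L) (ℤₚ.+-injective
    (trans (cong (λ w → ℤ.+ (e + i) ℤ.+ w) (ℤₚ.pos-* c L)) eq)))
  go ℤ.-[1+ c ] eq = trans (cong (_% L) (ℤₚ.+-injective (begin
    ℤ.+ (e + i)                                                  ≡⟨ ℤₚ.+-identityʳ (ℤ.+ (e + i)) ⟨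
    ℤ.+ (e + i) ℤ.+ ℤ.+ 0                                       ≡⟨ cong (λ w → ℤ.+ (e + i) ℤ.+ w) (ℤₚ.+-inverseˡ d) ⟨
    ℤ.+ (e + i) ℤ.+ (ℤ.- d ℤ.+ d)                               ≡⟨ ℤₚ.+-assoc (ℤ.+ (e + i)) (ℤ.- d) d ⟨
    ℤ.+ (e + i) ℤ.+ ℤ.- d ℤ.+ d
      ≡⟨ cong (λ w → ℤ.+ (e + i) ℤ.+ w ℤ.+ d) (ℤₚ.neg-distribˡ-* (ℤ.+ suc c) (ℤ.+ L)) ⟩
    ℤ.+ (e + i) ℤ.+ ℤ.-[1+ c ] ℤ.* ℤ.+ L ℤ.+ d                  ≡⟨ cong (λ w → w ℤ.+ d) eq ⟩
    ℤ.+ k ℤ.+ d                                                   ≡⟨ cong (λ w → ℤ.+ k ℤ.+ w) (ℤₚ.pos-* (suc c) L) ⟨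
    ℤ.+ (k + suc c * L)                                           ∎))) ([m+kn]%n≡m%n k (suc c) L)
    where d = ℤ.+ suc c ℤ.* ℤ.+ L

-- Coordinates of a partitioned order, and its blocks

module _ (μ : BP n) where

  rows : List (List (Fin n))
  rows = map toList (oblocks μ)

  block-of : Fin n → List⁺ (Fin n)
  block-of x = proj₁ (find (cover μ x))

  -- Read off the witness that `cover` happens to supply; by `At-unique` any other occurrence of `x`
  -- gives the same values.
  sz pos : Fin n → ℕ
  sz x  = List⁺.length (block-of x)
  pos x = proj₁ (Any⇒Nth (proj₂ (proj₂ (find (cover μ x)))))

  At-coords : ∀ x → At rows x (sz x) (pos x)
  At-coords x = Anyₚ.map⁺ (lose (proj₁ (proj₂ (find (cover μ x))))
    (refl , Nth-map sym (proj₂ (Any⇒Nth (proj₂ (proj₂ (find (cover μ x))))))))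

  At-unique : ∀ {x j ℓ} → At rows x j ℓ → j ≡ sz x × ℓ ≡ pos x
  At-unique {x} at = At-functional (Allₚ.map⁺ (distinct μ)) (AllPairsₚ.map⁺ (disjoint μ)) at (At-coords x)

  pos<sz : ∀ x → pos x < sz x
  pos<sz x = Nth⇒< (proj₂ (Any⇒Nth (proj₂ (proj₂ (find (cover μ x))))))

  entry : ℕ → List⁺ (Fin n) → Fin n
  entry t S = lookup (toList S) (t mod List⁺.length S)

  toℕ-mod : ∀ t s .{{_ : NonZero s}} → toℕ (t mod s) ≡ t % s
  toℕ-mod t s = Finₚ.toℕ-fromℕ< (m%n<n t s)

  At-entry : ∀ {S} → S ∈ oblocks μ → ∀ t → At rows (entry t S) (List⁺.length S) (t % List⁺.length S)
  At-entry {S} S∈ t = Anyₚ.map⁺ (lose S∈ (refl ,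
    subst (Nth (_≡ entry t S) (toList S)) (toℕ-mod t (List⁺.length S)) (Nth-lookup (toList S) (t mod List⁺.length S))))

  entry-Nth : ∀ {S x ℓ} t → Nth (_≡ x) (toList S) ℓ → ℓ ≡ t % List⁺.length S → entry t S ≡ x
  entry-Nth {S} t p refl = Nth-unique
    (subst (Nth (_≡ entry t S) (toList S)) (toℕ-mod t (List⁺.length S)) (Nth-lookup (toList S) (t mod List⁺.length S))) p

  ∈W : ∀ t x → x ∈ₛ W μ t ⇔ t % sz x ≡ pos x
  ∈W t x = mk⇔ fwd bwd
    where
    fwd : x ∈ₛ W μ t → t % sz x ≡ pos x
    fwd x∈ with find (Anyₚ.map⁻ (∈-⋃⁻ _ x∈))
    ... | S , S∈ , x∈S with refl ← x∈⁅y⁆⇒x≡y (entry t S) x∈S =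
      let len≡ , ℓ≡ = At-unique (At-entry S∈ t) in trans (%-congʳ {o = t} (sym len≡)) ℓ≡
    bwd : t % sz x ≡ pos x → x ∈ₛ W μ t
    bwd eq with S , S∈ , len , p ← find (Anyₚ.map⁻ (At-coords x)) =
      ∈-⋃⁺ (Anyₚ.map⁺ (lose S∈ (subst (λ y → x ∈ₛ ⁅ y ⁆) (sym (entry-Nth t p (trans (sym eq) (%-congʳ {o = t} (sym len))))) (x∈⁅x⁆ x))))

  sz∣period : ∀ x → sz x ∣ period μ
  sz∣period x = go (oblocks μ) (proj₁ (proj₂ (find (cover μ x))))
    where
    go : ∀ Ss {S} → S ∈ Ss → List⁺.length S ∣ foldr lcm 1 (map List⁺.length Ss)
    go (S ∷ Ss) (here refl) = m∣lcm[m,n] (List⁺.length S) (foldr lcm 1 (map List⁺.length Ss))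
    go (S ∷ Ss) (there S∈)  = ∣-trans (go Ss S∈) (n∣lcm[m,n] (List⁺.length S) (foldr lcm 1 (map List⁺.length Ss)))

  period-least : ∀ {c} → (∀ x → sz x ∣ c) → period μ ∣ c
  period-least {c} h = go (oblocks μ) id
    where
    go : ∀ Ss → (∀ {S} → S ∈ Ss → S ∈ oblocks μ) → foldr lcm 1 (map List⁺.length Ss) ∣ c
    go []       _   = 1∣ c
    go (S ∷ Ss) sub = lcm-least
      -- The entry of `S` at time 0 is an element whose size is the length of `S`, so `h` applies to
      -- it.
      (subst (_∣ c) (sym (proj₁ (At-unique (At-entry (sub (here refl)) 0)))) (h _)) (go Ss (sub ∘ there))

  period≢0 : NonZero (period μ)
  period≢0 = go (oblocks μ)
    where
    go : ∀ Ss → NonZero (foldr lcm 1 (map List⁺.length Ss))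
    go []       = _
    -- The lcm divides the nonzero product `s * c`.
    go (S ∷ Ss) = ≢-nonZero λ eq → ≢-nonZero⁻¹ (s * c) {{m*n≢0 s c {{_}} {{go Ss}}}}
      (0∣⇒≡0 (subst (_∣ s * c) eq (lcm-least (m∣m*n c) (n∣m*n s))))
      where
      s = List⁺.length S
      c = foldr lcm 1 (map List⁺.length Ss)

  length-φ : length (φ μ) ≡ period μ
  length-φ = trans (Listₚ.length-map (W μ) (upTo (period μ))) (Listₚ.length-upTo (period μ))

  φ-Nth : ∀ {t} → t < period μ → Nth (_≡ W μ t) (φ μ) t
  φ-Nth {t} t< = Nth-map⁺ (upTo-Nth (period μ) id t<)
    where
    upTo-Nth : ∀ p (f : ℕ → ℕ) {t} → t < p → Nth (λ u → W μ u ≡ W μ (f t)) (applyUpTo f p) t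
    upTo-Nth (suc p) f {zero}  _        = here refl
    upTo-Nth (suc p) f {suc t} (s<s t<) = there (upTo-Nth p (f ∘ suc) t<)

σ-Nth : ∀ (μ : BP n) .{{_ : NonZero (period μ)}} i {t} → t < period μ →
        ∃ λ e → Nth (_≡ W μ e) (σ (ℤ.+ i) (φ μ)) t × (e + i) % period μ ≡ t % period μ
σ-Nth μ i {t} t< =
  e , subst (Nth (_≡ W μ e) (σ (ℤ.+ i) (φ μ))) toℕ-k (subst (λ C → Nth (_≡ C) (σ (ℤ.+ i) (φ μ)) (toℕ k)) entry≡ (Nth-tabulate _ k)) ,
  (begin
    (e + i) % period μ         ≡⟨ %-congʳ (sym (length-φ μ)) ⟩
    (e + i) % length (φ μ)     ≡⟨ %ℕ-shift (toℕ k) i (length (φ μ)) ⟩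
    toℕ k % length (φ μ)       ≡⟨ %-congʳ (length-φ μ) ⟩
    toℕ k % period μ           ≡⟨ cong (_% period μ) toℕ-k ⟩
    t % period μ               ∎)
  where
  open ≡-Reasoning
  t<len = subst (t <_) (sym (length-φ μ)) t<
  k = fromℕ< t<len
  toℕ-k = Finₚ.toℕ-fromℕ< t<len
  instance
    _ = Finₚ.nonZeroIndex k
  z = ℤ.+ toℕ k ℤ.- ℤ.+ i
  e = z %ℕ length (φ μ)
  e< = n%ℕd<d z (length (φ μ))
  entry≡ : lookup (φ μ) (fromℕ< e<) ≡ W μ e
  entry≡ = Nth-unique (subst (Nth _ (φ μ)) (Finₚ.toℕ-fromℕ< e<) (Nth-lookup (φ μ) (fromℕ< e<)))
                      (φ-Nth μ (subst (e <_) (length-φ μ) e<))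

-- The relation `_≡⋆_` as a common shift of positions

length-σ : ∀ i (xs : List X) → length (σ i xs) ≡ length xs
length-σ i xs = Listₚ.length-tabulate {n = length xs} _

Shifted : (μ μ′ : BP n) → ℕ → Set
Shifted μ μ′ i = ∀ x → sz μ x ≡ sz μ′ x × pos μ x ≡ (pos μ′ x + i) % sz μ x

-- The times at which `x` is updated form a residue class modulo its size. By `same` the classes for
-- the two orders are translates by `i`, which forces equal moduli and positions differing by `i`.
≡⋆⇒Shifted : ∀ (μ μ′ : BP n) → μ ≡⋆ μ′ → ∃ (Shifted μ μ′)
≡⋆⇒Shifted μ μ′ (i′ , eq) = i , λ x → s≡s′ x , sym (from (same x (pos μ′ x)) (m<n⇒m%n≡m (pos<sz μ′ x)))
  where
  i = toℕ i′
  instance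
    _ = period≢0 μ
    _ = period≢0 μ′
  period≡ : period μ ≡ period μ′
  period≡ = trans (sym (length-φ μ)) (trans (cong length eq) (trans (length-σ (ℤ.+ i) (φ μ′)) (length-φ μ′)))
  same : ∀ x t → (t + i) % sz μ x ≡ pos μ x ⇔ t % sz μ′ x ≡ pos μ′ x
  same x t = mk⇔
    (λ h → trans (sym e≡t) (to (∈W μ′ e x) (subst (x ∈ₛ_) W≡ (from (∈W μ k x) (trans k≡ h)))))
    (λ h → trans (sym k≡) (to (∈W μ k x) (subst (x ∈ₛ_) (sym W≡) (from (∈W μ′ e x) (trans e≡t h)))))
    where
    P = period μ
    k = (t + i) % P
    k< = m%n<n (t + i) P
    shift = σ-Nth μ′ i (subst (k <_) period≡ k<)
    e = proj₁ shift
    W≡ : W μ k ≡ W μ′ e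
    W≡ = Nth-unique (φ-Nth μ k<) (subst (λ xs → Nth (_≡ W μ′ e) xs k) (sym eq) (proj₁ (proj₂ shift)))
    k≡ : k % sz μ x ≡ (t + i) % sz μ x
    k≡ = m∣n⇒o%n%m≡o%m (sz μ x) P (t + i) (sz∣period μ x)
    e≡t : e % sz μ′ x ≡ t % sz μ′ x
    e≡t = %-cancelʳ-+ e t i (sz μ′ x) (%-∣ (sz∣period μ′ x) (trans (proj₂ (proj₂ shift))
      (trans (%-congʳ (sym period≡)) (trans (m%n%n≡m%n (t + i) P) (%-congʳ period≡)))))
  base : ∀ x → (pos μ′ x + i) % sz μ x ≡ pos μ x
  base x = from (same x (pos μ′ x)) (m<n⇒m%n≡m (pos<sz μ′ x))
  s≡s′ : ∀ x → sz μ x ≡ sz μ′ x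
  s≡s′ x = ∣-antisym s∣s′ s′∣s
    where
    s = sz μ x
    s′ = sz μ′ x
    q = pos μ x
    q′ = pos μ′ x
    -- For μ′ the updates of `x` recur after `s′` steps, hence also for μ, and so `s` divides `s′`.
    s∣s′ : s ∣ s′
    s∣s′ = %-shift-∣ (q′ + i) s′ s (trans (cong (_% s) (trans (sym (+-assoc s′ q′ i)) (cong (_+ i) (+-comm s′ q′))))
      (trans (from (same x (q′ + s′)) (trans ([m+n]%n≡m%n q′ s′) (m<n⇒m%n≡m (pos<sz μ′ x)))) (sym (base x))))
    s′∣s : s′ ∣ s
    s′∣s = %-shift-∣ q′ s s′ (trans (cong (_% s′) (+-comm s q′)) (trans (to (same x (q′ + s)) (begin
      (q′ + s + i) % s   ≡⟨ cong (_% s) (trans (+-assoc q′ s i) (trans (cong (q′ +_) (+-comm s i)) (sym (+-assoc q′ i s)))) ⟩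
      (q′ + i + s) % s   ≡⟨ [m+n]%n≡m%n (q′ + i) s ⟩
      (q′ + i) % s       ≡⟨ base x ⟩
      q                  ∎)) (sym (m<n⇒m%n≡m (pos<sz μ′ x)))))
      where open ≡-Reasoning

Shifted⇒≡⋆ : ∀ (μ μ′ : BP n) {i} → Shifted μ μ′ i → μ ≡⋆ μ′
Shifted⇒≡⋆ {n} μ μ′ {i} sh = fromℕ< i₀< , subst (λ j → φ μ ≡ σ (ℤ.+ j) (φ μ′)) (sym (Finₚ.toℕ-fromℕ< i₀<))
  (Nth-ext (W μ) (trans (length-φ μ) (trans period≡ (sym (trans (length-σ (ℤ.+ i₀) (φ μ′)) (length-φ μ′)))))
    (λ t< → φ-Nth μ (subst (_ <_) (length-φ μ) t<)) shifted)
  where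
  instance
    _ = period≢0 μ
    _ = period≢0 μ′
  -- The witness has to index `φ μ′`. Reducing the shift is harmless because every size divides the
  -- period.
  i₀ = i % period μ′
  i₀< : i₀ < length (φ μ′)
  i₀< = subst (i₀ <_) (sym (length-φ μ′)) (m%n<n i (period μ′))
  period≡ : period μ ≡ period μ′
  period≡ = ∣-antisym
    (period-least μ λ x → subst (_∣ period μ′) (sym (proj₁ (sh x))) (sz∣period μ′ x))
    (period-least μ′ λ x → subst (_∣ period μ) (proj₁ (sh x)) (sz∣period μ x))
  W≡ : ∀ {t e} → (e + i₀) % period μ′ ≡ t % period μ′ → W μ′ e ≡ W μ t
  W≡ {t} {e} eq = subset-ext λ x →
    let s = sz μ x
        s≡ , q≡ = sh x
        e≡t : (e + i) % s ≡ t % s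
        e≡t = trans (%-∣ (subst (_∣ period μ′) (sym s≡) (sz∣period μ′ x)) (begin
          (e + i) % period μ′               ≡⟨ cong (_% period μ′) (+-comm e i) ⟩
          (i + e) % period μ′               ≡⟨ %-congˡ-+ i₀ i e (period μ′) (m%n%n≡m%n i (period μ′)) ⟨
          (i₀ + e) % period μ′              ≡⟨ cong (_% period μ′) (+-comm i₀ e) ⟩
          (e + i₀) % period μ′              ∎))
          (%-∣ (subst (_∣ period μ′) (sym s≡) (sz∣period μ′ x)) eq)
        pos% : pos μ′ x % s ≡ pos μ′ x
        pos% = m<n⇒m%n≡m (subst (pos μ′ x <_) (sym s≡) (pos<sz μ′ x))
    in mk⇔
      (λ x∈ → from (∈W μ t x) (trans (sym e≡t) (trans (%-congˡ-+ e (pos μ′ x) i s (trans (%-congʳ {o = e} s≡) (trans (to (∈W μ′ e x) x∈) (sym pos%)))) (sym q≡))))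
      (λ x∈ → from (∈W μ′ e x) (trans (%-congʳ {o = e} (sym s≡)) (trans (%-cancelʳ-+ e (pos μ′ x) i s (trans e≡t (trans (to (∈W μ t x) x∈) q≡))) pos%)))
    where open ≡-Reasoning
  shifted : ∀ {t} → t < length (σ (ℤ.+ i₀) (φ μ′)) → Nth (_≡ W μ t) (σ (ℤ.+ i₀) (φ μ′)) t
  shifted {t} t<
    with e , p , eq ← σ-Nth μ′ i₀ (subst (t <_) (trans (length-σ (ℤ.+ i₀) (φ μ′)) (length-φ μ′)) t<) =
    Nth-map (λ h → trans h (W≡ eq)) p

-- Bézout yields `c′` with b c′ congruent to -g modulo `k`. Writing v = r + h g with r < g, the
-- multiple b c′ h cancels h g and leaves r.
shift-residue : ∀ b k .{{_ : NonZero k}} v → ∃ λ t → (v + b * t) % k < gcd b k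
shift-residue b k@(suc k′) v = c′ * h , subst (_< g) (sym residue) r<g
  where
  open ≡-Reasoning
  g = gcd b k
  instance
    g≢0 : NonZero g
    g≢0 = ≢-nonZero (gcd[m,n]≢0 b k (inj₂ λ ()))
  r = v % g
  h = v / g
  r<g : r < g
  r<g = m%n<n v g
  negation : Bézout.Identity g b k → ∃₂ λ c′ z → g + b * c′ ≡ z * k
  negation (Bézout.-+ x y eq) = x , y , trans (cong (g +_) (*-comm b x)) eq
  -- Here x b is congruent to +g; multiplying `x` by `k′`, which is -1 modulo `k`, corrects the
  -- sign.
  negation (Bézout.+- x y eq) = x * k′ , g + y * k′ , (begin
    g + b * (x * k′)          ≡⟨ cong (g +_) (*-assoc b x k′) ⟨
    g + b * x * k′            ≡⟨ cong (λ w → g + w * k′) (trans (*-comm b x) (sym eq)) ⟩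
    g + (g + y * k) * k′      ≡⟨ identity g y k′ ⟩
    (g + y * k′) * k          ∎)
    where
    identity : ∀ g y k′ → g + (g + y * suc k′) * k′ ≡ (g + y * k′) * suc k′
    identity = solve-∀
  bezout = negation (Bézout.identity (gcd-GCD b k))
  c′ = proj₁ bezout
  z = proj₁ (proj₂ bezout)
  residue : (v + b * (c′ * h)) % k ≡ r
  residue = begin
    (v + b * (c′ * h)) % k              ≡⟨ cong (λ w → (w + b * (c′ * h)) % k) (m≡m%n+[m/n]*n v g) ⟩
    (r + h * g + b * (c′ * h)) % k      ≡⟨ cong (_% k) (identity r h g b c′) ⟩
    (r + h * (g + b * c′)) % k          ≡⟨ cong (λ w → (r + h * w) % k) (proj₂ (proj₂ bezout)) ⟩
    (r + h * (z * k)) % k               ≡⟨ cong (λ w → (r + w) % k) (*-assoc h z k) ⟨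
    (r + h * z * k) % k                 ≡⟨ [m+kn]%n≡m%n r (h * z) k ⟩
    r % k                               ≡⟨ m<n⇒m%n≡m (<-≤-trans r<g (∣⇒≤ (gcd[m,n]∣n b k))) ⟩
    r                                   ∎
    where
    identity : ∀ r h g b c′ → r + h * g + b * (c′ * h) ≡ r + h * (g + b * c′)
    identity = solve-∀

-- The loop that fills the array of bounds

[≔]-same : ∀ a j v → (a [ j ≔ v ]) j ≡ v
[≔]-same a j v with j ≟ j
... | yes _   = refl
... | no  j≢j = contradiction refl j≢j

[≔]-other : ∀ a j v {k} → k ≢ j → (a [ j ≔ v ]) k ≡ a k
[≔]-other a j v {k} k≢j with k ≟ j
... | yes k≡j = contradiction k≡j k≢j
... | no  _   = refl

module _ (p : List ℕ) where

  -- The loop only goes down, so entries above its counter are final.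
  fillA-above : ∀ j b a {k} → j < k → fillA p j b a k ≡ a k
  fillA-above zero    b a _   = refl
  fillA-above (suc j) b a j<k with 0 <? mult p (suc j)
  ... | yes _ = trans (fillA-above j _ _ (<⇒≤ j<k)) ([≔]-other a (suc j) _ (>⇒≢ j<k))
  ... | no  _ = trans (fillA-above j b _ (<⇒≤ j<k)) ([≔]-other a (suc j) _ (>⇒≢ j<k))

  fillA-∣ : ∀ j b a {k} → 0 < k → k ≤ j → 0 < mult p k → fillA p j b a k ∣ k
  fillA-∣ zero    b a 0<k k≤0 _ = contradiction k≤0 (<⇒≱ 0<k)
  fillA-∣ (suc j) b a 0<k k≤ 0<m with 0 <? mult p (suc j) | m≤n⇒m<n∨m≡n k≤
  ... | yes _   | inj₁ (s<s k≤j) = fillA-∣ j _ _ 0<k k≤j 0<m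
  ... | no  _   | inj₁ (s<s k≤j) = fillA-∣ j b _ 0<k k≤j 0<m
  ... | no  m≯0 | inj₂ refl = contradiction 0<m m≯0
  ... | yes _   | inj₂ refl
    rewrite fillA-above j (lcm b (suc j)) (a [ suc j ≔ gcd b (suc j) ]) {suc j} ≤-refl
          | [≔]-same a (suc j) (gcd b (suc j)) = gcd[m,n]∣n b (suc j)

  -- Here b always divides I, being the lcm of sizes already known to divide I,
  -- so that the entry gcd(b, k) of a divides I as well.
  fillA-divides : ∀ {I} j b a → b ∣ I →
    (∀ {k} → 0 < k → k ≤ j → 0 < mult p k → fillA p j b a k ∣ I → k ∣ I) →
    ∀ {k} → 0 < k → k ≤ j → 0 < mult p k → k ∣ I
  fillA-divides zero b a _ _ 0<k k≤0 _ = contradiction k≤0 (<⇒≱ 0<k)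
  fillA-divides {I} (suc j) b a b∣I hyp {k} 0<k k≤ 0<m with 0 <? mult p (suc j)
  ... | no m≯0 with m≤n⇒m<n∨m≡n k≤
  ...   | inj₂ refl = contradiction 0<m m≯0
  ...   | inj₁ (s<s k≤j) = fillA-divides j b _ b∣I (λ 0<k k≤j → hyp 0<k (m≤n⇒m≤1+n k≤j)) 0<k k≤j 0<m
  fillA-divides {I} (suc j) b a b∣I hyp {k} 0<k k≤ 0<m | yes 0<m₀ = case m≤n⇒m<n∨m≡n k≤ of λ
    { (inj₂ refl)      → top
    ; (inj₁ (s<s k≤j)) → fillA-divides j (lcm b (suc j)) _ (lcm-least b∣I top)
                           (λ 0<k k≤j → hyp 0<k (m≤n⇒m≤1+n k≤j)) 0<k k≤j 0<m }
    where
    top : suc j ∣ I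
    top = hyp z<s ≤-refl 0<m₀ (subst (_∣ I)
      (sym (trans (fillA-above j _ _ ≤-refl) ([≔]-same a (suc j) _))) (∣-trans (gcd[m,n]∣m b (suc j)) b∣I))

  -- A greedy choice: at each size that occurs, a multiple of `b` brings the residue below the gcd.
  -- All later corrections are multiples of the new lcm and so keep that residue. The clause on `t`
  -- is the strengthening that makes this work inductively.
  fillA-shift : ∀ (u : ℕ → ℕ) j b a i₀ → ∃ λ i → (∃ λ t → i ≡ i₀ + b * t) ×
    (∀ k .{{_ : NonZero k}} → k ≤ j → 0 < mult p k → (u k + i) % k < fillA p j b a k)
  fillA-shift u zero b a i₀ = i₀ , (0 , sym (trans (cong (i₀ +_) (*-zeroʳ b)) (+-identityʳ i₀))) ,
    λ k k≤0 → contradiction k≤0 (<⇒≱ (>-nonZero⁻¹ k))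
  fillA-shift u (suc j) b a i₀ with 0 <? mult p (suc j)
  ... | no m≯0 =
    let i , t , bound = fillA-shift u j b (a [ suc j ≔ suc j ]) i₀
    in i , t , λ k k≤ 0<m → case m≤n⇒m<n∨m≡n k≤ of λ
         { (inj₁ (s<s k≤j)) → bound k k≤j 0<m
         ; (inj₂ refl)      → contradiction 0<m m≯0 }
  ... | yes _ =
    i , (t + c * t′ , i≡) , λ k k≤ 0<m → case m≤n⇒m<n∨m≡n k≤ of λ
      { (inj₁ (s<s k≤j)) → proj₂ (proj₂ rec) k k≤j 0<m
      ; (inj₂ refl)      → subst₂ _<_ (sym same)
          (sym (trans (fillA-above j _ _ ≤-refl) ([≔]-same a (suc j) _))) (proj₂ here-shift) }
    where
    open ≡-Reasoning
    j⁺ = suc j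
    here-shift = shift-residue b j⁺ (u j⁺ + i₀)
    t = proj₁ here-shift
    i₁ = i₀ + b * t
    rec = fillA-shift u j (lcm b j⁺) (a [ j⁺ ≔ gcd b j⁺ ]) i₁
    i = proj₁ rec
    t′ = proj₁ (proj₁ (proj₂ rec))
    -- The factor lcm / b, which rewrites later corrections as multiples of `b`.
    c = quotient (m∣lcm[m,n] b j⁺)
    i≡ : i ≡ i₀ + b * (t + c * t′)
    i≡ = begin
      i                              ≡⟨ proj₂ (proj₁ (proj₂ rec)) ⟩
      i₀ + b * t + lcm b j⁺ * t′      ≡⟨ cong (λ w → i₀ + b * t + w * t′) (_∣_.equality (m∣lcm[m,n] b j⁺)) ⟩
      i₀ + b * t + c * b * t′        ≡⟨ identity i₀ b t c t′ ⟩
      i₀ + b * (t + c * t′)          ∎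
      where
      identity : ∀ i₀ b t c t′ → i₀ + b * t + c * b * t′ ≡ i₀ + b * (t + c * t′)
      identity = solve-∀
    same : (u j⁺ + i) % j⁺ ≡ (u j⁺ + i₀ + b * t) % j⁺
    same = begin
      (u j⁺ + i) % j⁺                         ≡⟨ cong (λ w → (u j⁺ + w) % j⁺) (proj₂ (proj₁ (proj₂ rec))) ⟩
      (u j⁺ + (i₁ + lcm b j⁺ * t′)) % j⁺       ≡⟨ cong (_% j⁺) (identity (u j⁺) i₀ (b * t) (lcm b j⁺ * t′)) ⟩
      (u j⁺ + i₀ + b * t + lcm b j⁺ * t′) % j⁺ ≡⟨ %-remove-+ʳ (u j⁺ + i₀ + b * t) (∣m⇒∣m*n t′ (n∣lcm[m,n] b j⁺)) ⟩
      (u j⁺ + i₀ + b * t) % j⁺                ∎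
      where
      identity : ∀ w x y z → w + (x + y + z) ≡ w + x + y + z
      identity = solve-∀

-- Partitions and their multiplicities

module _ {p : List ℕ} {i : ℕ} where

  mult>0⇒∈ : 0 < mult p i → i ∈ p
  mult>0⇒∈ 0<m with filter (i ≟_) p in eq
  mult>0⇒∈ ()  | []
  mult>0⇒∈ _   | x ∷ xs with x∈p , refl ← ∈-filter⁻ (i ≟_) {xs = p} (subst (x ∈_) (sym eq) (here refl)) = x∈p

  ∈⇒mult>0 : i ∈ p → 0 < mult p i
  ∈⇒mult>0 = Listₚ.filter-some (i ≟_)

mult-∷-cancel : ∀ x p q i → mult (x ∷ p) i ≡ mult (x ∷ q) i → mult p i ≡ mult q i
mult-∷-cancel x p q i eq with i ≟ x
... | yes i≡x rewrite Listₚ.filter-accept (i ≟_) {x} {p} i≡x | Listₚ.filter-accept (i ≟_) {x} {q} i≡x = suc-injective eq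
... | no  i≢x rewrite Listₚ.filter-reject (i ≟_) {x} {p} i≢x | Listₚ.filter-reject (i ≟_) {x} {q} i≢x = eq

∈-∷-≤ : ∀ {x y : ℕ} {q} → All (y ≥_) q → x ∈ y ∷ q → x ≤ y
∈-∷-≤ _  (here refl) = ≤-refl
∈-∷-≤ y≥ (there x∈)  = All.lookup y≥ x∈

-- Each head is the maximum of its list and, by the multiplicities, occurs in the other list; so the
-- heads agree and can be cancelled.
descending-≡ : ∀ {p q} → AllPairs _≥_ p → AllPairs _≥_ q → (∀ i → mult p i ≡ mult q i) → p ≡ q
descending-≡ {[]}    {[]}    _ _ _  = refl
descending-≡ {[]}    {y ∷ q} _ _ eq = contradiction (eq y) (<⇒≢ (∈⇒mult>0 {y ∷ q} (here refl)))
descending-≡ {x ∷ p} {[]}    _ _ eq = contradiction (eq x) (>⇒≢ (∈⇒mult>0 {x ∷ p} (here refl)))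
descending-≡ {x ∷ p} {y ∷ q} (x≥ ∷ p≥) (y≥ ∷ q≥) eq with refl ← ≤-antisym
    (∈-∷-≤ y≥ (mult>0⇒∈ {y ∷ q} (subst (0 <_) (eq x) (∈⇒mult>0 {x ∷ p} (here refl)))))
    (∈-∷-≤ x≥ (mult>0⇒∈ {x ∷ p} (subst (0 <_) (sym (eq y)) (∈⇒mult>0 {y ∷ q} (here refl))))) =
  cong (x ∷_) (descending-≡ p≥ q≥ λ i → mult-∷-cancel x p q i (eq i))

-- Fillings with prescribed coordinates

module _ (p : List ℕ) (s q : Fin n → ℕ) (q<s : ∀ x → q x < s x)
         (count : ∀ {i ℓ} → ℓ < i → ∃ λ C → (∀ x → x ∈ₛ C ⇔ (s x ≡ i × q x ≡ ℓ)) × ∣ C ∣ ≡ mult p i) where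

  mult-s>0 : ∀ x → 0 < mult p (s x)
  mult-s>0 x with C , h , eq ← count (q<s x) = subst (0 <_) eq (n≢0⇒n>0 λ ∣C∣≡0 → ∣∣≡0⇒Empty C ∣C∣≡0 (x , from (h x) (refl , refl)))

  -- `A` holds the elements of size `i` whose column is still to be cut off, `k` columns in number.
  -- For `k` zero, `ℓ` has reached `i`, beyond every position, so `A` is empty.
  cut-columns : ∀ {i} k ℓ A → ℓ + k ≡ i → (∀ x → x ∈ₛ A ⇔ (s x ≡ i × ℓ ≤ q x)) →
    ∃ λ Cs → Split (mult p i) A Cs × length Cs ≡ k ×
             (∀ {x} → x ∈ₛ A → ∃ λ ℓ′ → Nth (x ∈ₛ_) Cs ℓ′ × ℓ + ℓ′ ≡ q x)
  cut-columns zero ℓ A eq h = [] , [] empty , refl , λ x∈ → contradiction (_ , x∈) empty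
    where
    empty : Empty A
    empty (x , x∈) = let s≡ , ℓ≤ = to (h x) x∈
                     in <⇒≱ (q<s x) (subst (_≤ q x) (trans (sym (+-identityʳ ℓ)) (trans eq (sym s≡))) ℓ≤)
  cut-columns {i} (suc k) ℓ A eq h =
    let C , hC , ∣C∣ = count (subst (ℓ <_) eq (m<m+n ℓ z<s))
        Cs , sp , len , pos = cut-columns k (suc ℓ) (A ─ C) (trans (sym (+-suc ℓ k)) eq) λ x → mk⇔
          (λ x∈ → let s≡ , ℓ≤ = to (h x) (p─q⊆p A C x∈)
                  in s≡ , ≤∧≢⇒< ℓ≤ λ ℓ≡ → x∈p─q⇒x∉q A C x∈ (from (hC x) (s≡ , sym ℓ≡)))
          (λ (s≡ , ℓ<) → x∈p∧x∉q⇒x∈p─q (from (h x) (s≡ , <⇒≤ ℓ<)) λ x∈C → <⇒≢ ℓ< (sym (proj₂ (to (hC x) x∈C))))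
    in C ∷ Cs ,
       ((λ {x} x∈ → let s≡ , q≡ = to (hC x) x∈ in from (h x) (s≡ , ≤-reflexive (sym q≡))) , ∣C∣) ∷ sp ,
       cong suc len , λ {x} x∈ → case x ∈? C of λ
         { (yes x∈C) → 0 , here x∈C , trans (+-identityʳ ℓ) (sym (proj₂ (to (hC x) x∈C)))
         ; (no  x∉C) → let ℓ′ , nth , ℓ≡ = pos (x∈p∧x∉q⇒x∈p─q x∈ x∉C)
                       in suc ℓ′ , there nth , trans (+-suc ℓ ℓ′) ℓ≡ }

  module _ (o : FixedOrders n) (a : ℕ → ℕ)
           (norm : ∀ {i A} → (∀ x → x ∈ₛ A ⇔ s x ≡ i) → ∀ ne → q (min A ne) < a i) where

    -- `k` counts the levels left and `U` holds the elements of untreated sizes. An element left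
    -- beyond the largest part would have a size of multiplicity zero, against `mult-s>0`.
    fill : ∀ k j U → j + k ≡ suc (maxPart p) → (∀ x → x ∈ₛ U ⇔ j ≤ s x) →
           ∃ λ Ns → Filling o p a j U Ns × (∀ {x} → x ∈ₛ U → At (concat Ns) x (s x) (q x))
    fill zero j U eq h = [] , done max<j , λ {x} x∈ →
      contradiction (mult-max o p a (<-≤-trans max<j (to (h x) x∈))) (>⇒≢ (mult-s>0 x))
      where max<j = ≤-reflexive (sym (trans (sym (+-identityʳ j)) eq))
    fill (suc k) j U eq h with 0 <? mult p j
    ... | no m≯0 =
      let Ns , F , at = fill k (suc j) U (trans (sym (+-suc j k)) eq) λ x → mk⇔
            (λ x∈ → ≤∧≢⇒< (to (h x) x∈) λ j≡ → m≯0 (subst (λ i → 0 < mult p i) (sym j≡) (mult-s>0 x)))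
            (from (h x) ∘ <⇒≤)
      in [] ∷ Ns , skip j≤max (n≤0⇒n≡0 (≮⇒≥ m≯0)) F , at
      where j≤max = s≤s⁻¹ (subst (suc j ≤_) (trans (sym (+-suc j k)) eq) (s≤s (m≤m+n j k)))
    ... | yes 0<m =
      let Cs , sp , len , pos = cut-columns j 0 A refl λ x → mk⇔ (λ x∈ → to (hA x) x∈ , z≤n) (from (hA x) ∘ proj₁)
          f : Filled o p a j U A Cs
          f = record
            { A⊆U   = λ {x} x∈ → from (h x) (≤-reflexive (sym (to (hA x) x∈)))
            ; ∣A∣   = trans (Split-∣∣ sp) (trans (cong (mult p j *_) len) (*-comm _ j))
            ; 0<m   = 0<m
            ; split = sp
            ; norm  = λ ne → let ℓ , nth , ℓ≡ = pos (min-∈ A ne)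
                             in ℓ , nth , subst (_< a j) (sym ℓ≡) (norm hA ne) }
          Ns , F , at = fill k (suc j) (U ─ A) (trans (sym (+-suc j k)) eq) λ x → mk⇔
            (λ x∈ → ≤∧≢⇒< (to (h x) (p─q⊆p U A x∈)) λ j≡ → x∈p─q⇒x∉q U A x∈ (from (hA x) (sym j≡)))
            (λ j< → x∈p∧x∉q⇒x∈p─q (from (h x) (<⇒≤ j<)) λ x∈A → <⇒≢ j< (sym (to (hA x) x∈A)))
      in fromColumns o (mult p j) Cs ∷ Ns , step j≤max f F , λ {x} x∈ → case x ∈? A of λ
        { (yes x∈A) → let ℓ , nth , ℓ≡ = pos x∈A
                      in Anyₚ.++⁺ˡ (from (Filled.At-head f) (to (hA x) x∈A , subst (Nth (x ∈ₛ_) Cs) ℓ≡ nth))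
        ; (no  x∉A) → Anyₚ.++⁺ʳ (fromColumns o (mult p j) Cs) (at (x∈p∧x∉q⇒x∈p─q x∈ x∉A)) }
      where
      j≤max = s≤s⁻¹ (subst (suc j ≤_) (trans (sym (+-suc j k)) eq) (s≤s (m≤m+n j k)))
      A = ⟪ (λ x → s x ≟ j) ⟫
      hA : ∀ x → x ∈ₛ A ⇔ s x ≡ j
      hA = ∈⟪⟫ (λ x → s x ≟ j)

-- Every o-block of size `i` contributes exactly one element, its entry at time `e`, and
-- disjointness makes these distinct. A time instead of a position lets the caller insert a shifted
-- value without reducing it.
count-entries : ∀ (μ : BP n) {i} .{{_ : NonZero i}} e →
  ∃ λ C → (∀ x → x ∈ₛ C ⇔ (sz μ x ≡ i × pos μ x ≡ e % i)) × ∣ C ∣ ≡ mult (map List⁺.length (oblocks μ)) i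
count-entries {n} μ {i} e = C , hC , (begin
  ∣ C ∣                                          ≡⟨ ∣∣≡length entries! hL ⟩
  length entries                                 ≡⟨ Listₚ.length-map (entry μ e) Ss ⟩
  length Ss                                      ≡⟨ length-filter-map (oblocks μ) ⟩
  mult (map List⁺.length (oblocks μ)) i          ∎)
  where
  open ≡-Reasoning
  P? : Decidable (λ x → sz μ x ≡ i × pos μ x ≡ e % i)
  P? x = (sz μ x ≟ i) ×-dec (pos μ x ≟ e % i)
  C = ⟪ P? ⟫
  hC = ∈⟪⟫ P?
  size? : Decidable (λ S → i ≡ List⁺.length S)
  size? S = i ≟ List⁺.length S
  Ss = filter size? (oblocks μ)
  entries = map (entry μ e) Ss
  length-filter-map : ∀ Ss → length (filter size? Ss) ≡ mult (map List⁺.length Ss) i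
  length-filter-map [] = refl
  length-filter-map (S ∷ Ss) with does (size? S)
  ... | true  = cong suc (length-filter-map Ss)
  ... | false = length-filter-map Ss
  entries! : Unique entries
  entries! = AllPairsₚ.map⁺ (AllPairsₚ.filter⁺ size? (AllPairs.map
    (λ {S} {T} dis eq → dis (∈-lookup (e mod List⁺.length S) , subst (_∈ toList T) (sym eq) (∈-lookup (e mod List⁺.length T))))
    (disjoint μ)))
  hL : ∀ x → x ∈ entries ⇔ x ∈ₛ C
  hL x = mk⇔ fwd bwd
    where
    fwd : x ∈ entries → x ∈ₛ C
    fwd x∈ with S , S∈ , refl ← ∈-map⁻ (entry μ e) x∈ with S∈μ , i≡ ← ∈-filter⁻ size? {xs = oblocks μ} S∈ =
      let len≡ , ℓ≡ = At-unique μ (At-entry μ S∈μ e)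
      in from (hC _) (trans (sym len≡) (sym i≡) , trans (sym ℓ≡) (%-congʳ {o = e} (sym i≡)))
    bwd : x ∈ₛ C → x ∈ entries
    bwd x∈ with sz≡ , pos≡ ← to (hC x) x∈ with S , S∈ , len , p ← find (Anyₚ.map⁻ (At-coords μ x)) =
      subst (_∈ entries) (entry-Nth μ e p (trans pos≡ (%-congʳ {o = e} (sym (trans len sz≡)))))
        (∈-map⁺ (entry μ e) (∈-filter⁺ size? S∈ (sym (trans len sz≡))))

-- Outputs as partitioned orders, and their uniqueness in a class

IsPartition⇒mult0 : ∀ {p} → IsPartition n p → mult p 0 ≡ 0
IsPartition⇒mult0 (_ , pos , _) = cong length (Listₚ.filter-none (0 ≟_) (All.map (λ { 0<0 refl → <-irrefl refl 0<0 }) pos))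

startA : List ℕ → ℕ → ℕ
startA p = fillA p (maxPart p) 1 (λ _ → 0)

module _ {p : List ℕ} (isP : IsPartition n p) where

  mult>0⇒bounds : ∀ {j} → 0 < mult p j → 0 < j × j ≤ maxPart p
  mult>0⇒bounds {j} 0<m with 0 <? j | j ≤? maxPart p
  ... | yes 0<j | yes j≤ = 0<j , j≤
  ... | no  0≮j | _ = contradiction 0<m (<-irrefl (sym (trans (cong (mult p) (n≤0⇒n≡0 (≮⇒≥ 0≮j))) (IsPartition⇒mult0 isP))))
  ... | _ | no j≰ = contradiction (All.lookup (Extrema.xs≤max 0 p) (mult>0⇒∈ 0<m)) j≰

  startA-∣ : ∀ {j} → 0 < mult p j → startA p j ∣ j
  startA-∣ 0<m = let 0<j , j≤ = mult>0⇒bounds 0<m in fillA-∣ p (maxPart p) 1 _ 0<j j≤ 0<m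

  startA-bounded : ∀ {j} → 0 < mult p j → 0 < startA p j × startA p j ≤ j
  startA-bounded {j} 0<m =
    n≢0⇒n>0 (λ a≡0 → >⇒≢ 0<j (0∣⇒≡0 (subst (_∣ j) a≡0 (startA-∣ 0<m)))) ,
    ∣⇒≤ {{>-nonZero 0<j}} (startA-∣ 0<m)
    where 0<j = proj₁ (mult>0⇒bounds 0<m)

nonempty-rows : ∀ (rs : List (List X)) → All (λ r → 0 < length r) rs → ∃ λ Ss → map toList Ss ≡ rs
nonempty-rows []             []         = [] , refl
nonempty-rows ((x ∷ r) ∷ rs) (_ ∷ pos) =
  let Ss , eq = nonempty-rows rs pos in (x List⁺.∷ r) ∷ Ss , cong ((x ∷ r) ∷_) eq

rows⇒BP : ∀ (rs : List (List (Fin n))) → Unique (concat rs) → (∀ x → x ∈ concat rs) → All (λ r → 0 < length r) rs →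
          ∃ λ μ → rs ≡ rows μ
rows⇒BP rs u cov nonempty with Ss , refl ← nonempty-rows rs nonempty =
  let distinct , disjoint = Unique-concat⁻ (map toList Ss) u
  in record
    { oblocks  = Ss
    ; distinct = Allₚ.map⁻ distinct
    ; disjoint = AllPairsₚ.map⁻ disjoint
    ; cover    = λ x → Anyₚ.map⁻ (∈-concat⁻ (map toList Ss) (cov x))
    } , refl

represents-At : ∀ M (μ : BP n) → M represents μ → ∀ {x i ℓ} → At (concat M) x i ℓ ⇔ (i ≡ sz μ x × ℓ ≡ pos μ x)
represents-At M μ rep {x} = mk⇔
  (λ at → At-unique μ (↭ₚ.Any-resp-↭ rep at))
  (λ { (refl , refl) → ↭ₚ.Any-resp-↭ (↭-sym rep) (At-coords μ x) })

-- The shift stands for i₁ - i₂: modulo the period of μ, and hence modulo every size, `period μ ∸ 1`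
-- is -1.
Shifted-cospan : ∀ (μ μ₁ μ₂ : BP n) {i₁ i₂} → Shifted μ₁ μ i₁ → Shifted μ₂ μ i₂ →
                 Shifted μ₁ μ₂ (i₁ + i₂ * (period μ ∸ 1))
Shifted-cospan μ μ₁ μ₂ {i₁} {i₂} sh₁ sh₂ x = s≡ , (begin
  pos μ₁ x                                         ≡⟨ proj₂ (sh₁ x) ⟩
  (q + i₁) % s                                     ≡⟨ %-remove-+ʳ (q + i₁) (∣n⇒∣m*n i₂ s∣P) ⟨
  (q + i₁ + i₂ * P) % s                            ≡⟨ cong (λ w → (q + i₁ + i₂ * w) % s) (m+[n∸m]≡n {1} (>-nonZero⁻¹ P {{period≢0 μ}})) ⟨
  (q + i₁ + i₂ * (1 + (P ∸ 1))) % s                ≡⟨ cong (_% s) (identity q i₁ i₂ (P ∸ 1)) ⟩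
  (q + i₂ + I) % s                                 ≡⟨ %-congˡ-+ ((q + i₂) % s) (q + i₂) I s (m%n%n≡m%n (q + i₂) s) ⟨
  ((q + i₂) % s + I) % s                           ≡⟨ cong (λ w → (w + I) % s) (trans (%-congʳ {o = q + i₂} s≡) (sym (proj₂ (sh₂ x)))) ⟩
  (pos μ₂ x + I) % s                               ∎)
  where
  open ≡-Reasoning
  s = sz μ₁ x
  q = pos μ x
  P = period μ
  I = i₁ + i₂ * (P ∸ 1)
  s≡ : s ≡ sz μ₂ x
  s≡ = trans (proj₁ (sh₁ x)) (sym (proj₁ (sh₂ x)))
  s∣P : s ∣ P
  s∣P = subst (_∣ P) (sym (proj₁ (sh₁ x))) (sz∣period μ x)
  identity : ∀ q i₁ i₂ k → q + i₁ + i₂ * (1 + k) ≡ q + i₂ + (i₁ + i₂ * k)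
  identity = solve-∀

module _ (o : FixedOrders n) where
  open FixedOrders o

  Output : List ℕ → List (Matrix n) → Set
  Output p M = IsPartition n p × Filling o p (startA p) 1 full M

  unused-[] : unused o [] ≡ full
  unused-[] = subset-ext λ x → mk⇔ (λ _ → ∈⊤) (λ _ → from (∈-unused o [] x) λ ())

  -- There are `i * mult p i` elements of size `i`, so cancelling `i` recovers the multiplicities.
  -- Zero cannot be cancelled, but it is never a part.
  Filling-≡ : ∀ {p p′ a a′ M M′} → IsPartition n p → IsPartition n p′ →
    Filling o p a 1 full M → Filling o p′ a′ 1 full M′ →
    (∀ x i → ∃ (At (concat M) x i) ⇔ ∃ (At (concat M′) x i)) → p ≡ p′
  Filling-≡ {p} {p′} isP isP′ F F′ same = descending-≡
    (Linked⇒AllPairs ≥-trans (proj₁ isP)) (Linked⇒AllPairs ≥-trans (proj₁ isP′)) mult≡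
    where
    ≥-trans : ∀ {i j k : ℕ} → i ≥ j → j ≥ k → i ≥ k
    ≥-trans i≥j j≥k = ≤-trans j≥k i≥j
    mult≡ : ∀ i → mult p i ≡ mult p′ i
    mult≡ zero      = trans (IsPartition⇒mult0 isP) (sym (IsPartition⇒mult0 isP′))
    mult≡ i@(suc _) =
      let A , h , eq , _ = Filling-Level o p _ F (s≤s z≤n)
          A′ , h′ , eq′ , _ = Filling-Level o p′ _ F′ (s≤s z≤n)
          A≡A′ = subset-ext λ x → mk⇔ (from (h′ x) ∘ to (same x i) ∘ to (h x)) (from (h x) ∘ from (same x i) ∘ to (h′ x))
      in *-cancelˡ-≡ (mult p i) (mult p′ i) i (trans (sym eq) (trans (cong ∣_∣ A≡A′) eq′))

  ∈-EnumBPiso : ∀ {M} → M ∈ EnumBPiso o ⇔ (∃ λ p → Output p M)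
  ∈-EnumBPiso {M} = mk⇔ fwd bwd
    where
    run = λ p → aux o p (startA p) 1 (<-wellFounded _) []
    fwd : M ∈ EnumBPiso o → ∃ λ p → Output p M
    fwd M∈ with p , p∈ , M∈p ← find (∈-concatMap⁻ run {xs = partitions} M∈) =
      let isP = All.lookup partitions-sound p∈
          Ns , eq , F = aux-sound o p (startA p) (startA-bounded isP) 1 (<-wellFounded _) [] M∈p
      in p , isP , subst₂ (Filling o p (startA p) 1) unused-[] (sym eq) F
    bwd : (∃ λ p → Output p M) → M ∈ EnumBPiso o
    bwd (p , isP , F) = ∈-concatMap⁺ run (lose (partitions-complete p isP)
      (aux-complete o p (startA p) (startA-bounded isP) 1 (<-wellFounded _) []
        (subst (λ U → Filling o p (startA p) 1 U M) (sym unused-[]) F)))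

  EnumBPiso-distinct : AllPairs (λ M M′ → ¬ SameCoords M M′) (EnumBPiso o)
  EnumBPiso-distinct = AllPairs-concatMap run partitions-unique
    (λ {p} p∈ → aux-distinct o p (startA p) (startA-bounded (All.lookup partitions-sound p∈)) 1 (<-wellFounded _) [])
    λ {p} {p′} p∈ p′∈ p≢p′ M∈ M′∈ (finer , finer′) →
      let isP  = All.lookup partitions-sound p∈
          isP′ = All.lookup partitions-sound p′∈
      in p≢p′ (Filling-≡ isP isP′ (sound isP M∈) (sound isP′ M′∈) λ x i →
           mk⇔ (λ (ℓ , at) → ℓ , finer at) (λ (ℓ , at) → ℓ , finer′ at))
    where
    run = λ p → aux o p (startA p) 1 (<-wellFounded _) []
    sound : ∀ {p M} → IsPartition n p → M ∈ run p → Filling o p (startA p) 1 full M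
    sound {p} isP M∈ =
      let Ns , eq , F = aux-sound o p (startA p) (startA-bounded isP) 1 (<-wellFounded _) [] M∈
      in subst₂ (Filling o p (startA p) 1) unused-[] (sym eq) F

  Output⇒BP : ∀ p M → Output p M → ∃ λ (μ : BP n) → M represents μ
  Output⇒BP p M ((_ , pos , sum≡) , F) =
    let u , h , nonempty = Filling-entries o p (startA p) F z<s
          -- All parts are positive, so at level 1 the filter keeps everything and the invariant
          -- starts as n = sum p.
          (trans (∣⊤∣≡n n) (sym (trans (cong sum (Listₚ.filter-all (1 ≤?_) pos)) sum≡)))
        μ , eq = rows⇒BP (concat M) u (λ x → from (h x) ∈⊤) nonempty
    in μ , ↭-reflexive eq

  module _ (p : List ℕ) (M : List (Matrix n)) (μ : BP n) (out : Output p M) (rep : M represents μ) where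

    sizes : ∀ i → 0 < i → ∃ λ A → (∀ x → x ∈ₛ A ⇔ sz μ x ≡ i) × ∣ A ∣ ≡ i * mult p i ×
                                  (∀ ne → pos μ (min A ne) < startA p i)
    sizes i 0<i =
      let A , h , eq , nm = Filling-Level o p (startA p) (proj₂ out) 0<i
      in A , (λ x → mk⇔ (λ x∈ → sym (proj₁ (to (represents-At M μ rep) (proj₂ (to (h x) x∈)))))
                        (λ sz≡ → from (h x) (_ , from (represents-At M μ rep) (sym sz≡ , refl)))) ,
         eq , λ ne → let ℓ , at , ℓ< = nm ne in subst (_< startA p i) (proj₂ (to (represents-At M μ rep) at)) ℓ<

    mult-sz>0 : ∀ x → 0 < mult p (sz μ x)
    mult-sz>0 x =
      let A , h , eq , _ = sizes (sz μ x) z<s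
      in n≢0⇒n>0 λ m≡0 → ∣∣≡0⇒Empty A (trans eq (trans (cong (sz μ x *_) m≡0) (*-zeroʳ (sz μ x)))) (x , from (h x) refl)

  SameCoords-intro : ∀ M M′ (μ μ′ : BP n) → M represents μ → M′ represents μ′ →
    (∀ x → sz μ x ≡ sz μ′ x × pos μ x ≡ pos μ′ x) → SameCoords M M′
  SameCoords-intro M M′ μ μ′ rep rep′ same =
    (λ {x} at → let i≡ , ℓ≡ = to (represents-At M μ rep) at ; s≡ , q≡ = same x
                in from (represents-At M′ μ′ rep′) (trans i≡ s≡ , trans ℓ≡ q≡)) ,
    (λ {x} at → let i≡ , ℓ≡ = to (represents-At M′ μ′ rep′) at ; s≡ , q≡ = same x
                in from (represents-At M μ rep) (trans i≡ (sym s≡) , trans ℓ≡ (sym q≡)))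

  Output-≡ : ∀ p p′ M M′ (μ₁ μ₂ : BP n) → Output p M → Output p′ M′ →
    M represents μ₁ → M′ represents μ₂ → (∀ x → sz μ₁ x ≡ sz μ₂ x) → p ≡ p′
  Output-≡ p p′ M M′ μ₁ μ₂ out out′ rep rep′ sz≡ = Filling-≡ (proj₁ out) (proj₁ out′) (proj₂ out) (proj₂ out′) λ x i → mk⇔
    (λ (_ , at) → _ , from (represents-At M′ μ₂ rep′) (trans (proj₁ (to (represents-At M μ₁ rep) at)) (sz≡ x) , refl))
    (λ (_ , at) → _ , from (represents-At M μ₁ rep) (trans (proj₁ (to (represents-At M′ μ₂ rep′) at)) (sym (sz≡ x)) , refl))

  module _ (p : List ℕ) (M M′ : List (Matrix n)) (μ₁ μ₂ : BP n) {I} (out : Output p M) (out′ : Output p M′)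
           (rep : M represents μ₁) (rep′ : M′ represents μ₂) (sh : Shifted μ₁ μ₂ I) where

    -- The minimum of A_k has position below a[k] in both outputs, so a shift
    -- divisible by a[k] fixes that position, and hence is divisible by k.
    min-fixed : ∀ {k} → 0 < k → 0 < mult p k → startA p k ∣ I → k ∣ I
    min-fixed {k} 0<k 0<m a∣I =
      %-shift-∣ (pos μ₂ x) I k (begin
        (I + pos μ₂ x) % k            ≡⟨ cong (_% k) (+-comm I (pos μ₂ x)) ⟩
        (pos μ₂ x + I) % k            ≡⟨ pos₁ ⟨
        pos μ₁ x                      ≡⟨ m<n⇒m%n≡m early ⟨
        pos μ₁ x % a                  ≡⟨ cong (_% a) pos₁ ⟩
        (pos μ₂ x + I) % k % a        ≡⟨ m∣n⇒o%n%m≡o%m a k (pos μ₂ x + I) (startA-∣ (proj₁ out) 0<m) ⟩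
        (pos μ₂ x + I) % a            ≡⟨ %-remove-+ʳ (pos μ₂ x) a∣I ⟩
        pos μ₂ x % a                  ≡⟨ m<n⇒m%n≡m early′ ⟩
        pos μ₂ x                      ≡⟨ m<n⇒m%n≡m (<-≤-trans early′ (proj₂ bounds)) ⟨
        pos μ₂ x % k                  ∎)
      where
      open ≡-Reasoning
      a = startA p k
      bounds = startA-bounded (proj₁ out) 0<m
      instance
        k≢0 = >-nonZero 0<k
        a≢0 = >-nonZero (proj₁ bounds)
        m≢0 = >-nonZero 0<m
        km≢0 = m*n≢0 k (mult p k)
      level  = sizes p M μ₁ out rep k 0<k
      level′ = sizes p M′ μ₂ out′ rep′ k 0<k
      A = proj₁ level
      h = proj₁ (proj₂ level)
      h′ = proj₁ (proj₂ level′)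
      A≡A′ : A ≡ proj₁ level′
      A≡A′ = subset-ext λ x → mk⇔ (λ x∈ → from (h′ x) (trans (sym (proj₁ (sh x))) (to (h x) x∈)))
                                   (λ x∈ → from (h x) (trans (proj₁ (sh x)) (to (h′ x) x∈)))
      ne = ∣∣-nonempty A (proj₁ (proj₂ (proj₂ level)))
      x = min A ne
      early : pos μ₁ x < a
      early = proj₂ (proj₂ (proj₂ level)) ne
      early′ : pos μ₂ x < a
      early′ = subst (λ B → ∀ ne → pos μ₂ (min B ne) < a) (sym A≡A′) (proj₂ (proj₂ (proj₂ level′))) ne
      pos₁ : pos μ₁ x ≡ (pos μ₂ x + I) % k
      pos₁ = trans (proj₂ (sh x)) (%-congʳ {o = pos μ₂ x + I} (to (h x) (min-∈ A ne)))

    Shifted⇒SameCoords : SameCoords M M′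
    Shifted⇒SameCoords = SameCoords-intro M M′ μ₁ μ₂ rep rep′ λ x → proj₁ (sh x) , (begin
      pos μ₁ x                    ≡⟨ proj₂ (sh x) ⟩
      (pos μ₂ x + I) % sz μ₁ x    ≡⟨ %-remove-+ʳ (pos μ₂ x) (sz∣I x) ⟩
      pos μ₂ x % sz μ₁ x          ≡⟨ m<n⇒m%n≡m (subst (pos μ₂ x <_) (sym (proj₁ (sh x))) (pos<sz μ₂ x)) ⟩
      pos μ₂ x                    ∎)
      where
      open ≡-Reasoning
      sz∣I : ∀ x → sz μ₁ x ∣ I
      sz∣I x = let 0<m = mult-sz>0 p M μ₁ out rep x
                   0<k , k≤max = mult>0⇒bounds (proj₁ out) 0<m
               -- The loop starts with b = 1, which divides any shift; from there every occurring
               -- size is shown to divide `I`.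
               in fillA-divides p (maxPart p) 1 (λ _ → 0) (1∣ I) (λ 0<k _ → min-fixed 0<k) 0<k k≤max 0<m

  ≡⋆⇒SameCoords : ∀ {M M′} (μ : BP n) {μ₁ μ₂} → M ∈ EnumBPiso o → M′ ∈ EnumBPiso o →
    M represents μ₁ → M′ represents μ₂ → μ₁ ≡⋆ μ → μ₂ ≡⋆ μ → SameCoords M M′
  ≡⋆⇒SameCoords {M} {M′} μ {μ₁} {μ₂} M∈ M′∈ rep rep′ eq₁ eq₂ =
    let p  , out  = to (∈-EnumBPiso {M}) M∈
        p′ , out′ = to (∈-EnumBPiso {M′}) M′∈
        i₁ , sh₁ = ≡⋆⇒Shifted μ₁ μ eq₁
        i₂ , sh₂ = ≡⋆⇒Shifted μ₂ μ eq₂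
        p≡p′ = Output-≡ p p′ M M′ μ₁ μ₂ out out′ rep rep′ (λ x → trans (proj₁ (sh₁ x)) (sym (proj₁ (sh₂ x))))
    in Shifted⇒SameCoords p M M′ μ₁ μ₂ out (subst (λ q → Output q M′) (sym p≡p′) out′) rep rep′
         (Shifted-cospan μ μ₁ μ₂ sh₁ sh₂)

  -- A normalised representative of a given class

  module _ (μ : BP n) where

    open Sort (Flip.decTotalOrder ≤-decTotalOrder) using (sort; sort-↭; sort-↗)

    lengths = map List⁺.length (oblocks μ)
    parts = sort lengths

    sum-lengths : sum lengths ≡ n
    sum-lengths = begin
      sum lengths              ≡⟨ sum-length (oblocks μ) ⟩
      length (concat (rows μ)) ≡⟨ ∣∣≡length {C = full} rows! (λ x → mk⇔ (λ _ → ∈⊤) (λ _ → At⇒∈ (At-coords μ x))) ⟨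
      ∣ full {n} ∣             ≡⟨ ∣⊤∣≡n n ⟩
      n                        ∎
      where
      open ≡-Reasoning
      rows! : Unique (concat (rows μ))
      rows! = Uniqueₚ.concat⁺ (Allₚ.map⁺ (distinct μ)) (AllPairsₚ.map⁺ (disjoint μ))
      sum-length : ∀ Ss → sum (map List⁺.length Ss) ≡ length (concat (map toList Ss))
      sum-length []       = refl
      sum-length (S ∷ Ss) = trans (cong (List⁺.length S +_) (sum-length Ss)) (sym (Listₚ.length-++ (toList S)))

    parts-IsPartition : IsPartition n parts
    parts-IsPartition = sort-↗ lengths ,
      ↭ₚ.All-resp-↭ (↭-sym (sort-↭ lengths)) (Allₚ.map⁺ (All.tabulate λ _ → z<s)) ,
      trans (sum-↭ (sort-↭ lengths)) sum-lengths

    mult-parts : ∀ i → mult lengths i ≡ mult parts i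
    mult-parts i = ↭ₚ.↭-length (↭ₚ.filter-↭ (i ≟_) (↭-sym (sort-↭ lengths)))

    A[_] : ℕ → Subset n
    A[ k ] = ⟪ (λ x → sz μ x ≟ k) ⟫

    pos-min : ℕ → ℕ
    pos-min k with nonempty? A[ k ]
    ... | yes ne = pos μ (min A[ k ] ne)
    -- A default that makes the function total; the bound from `fillA-shift` is applied only at
    -- sizes that occur.
    ... | no  _  = 0

    shift : ℕ
    shift = proj₁ (fillA-shift parts pos-min (maxPart parts) 1 (λ _ → 0) 0)

    shifted-pos : Fin n → ℕ
    shifted-pos x = (pos μ x + shift) % sz μ x

    shifted-count : ∀ {i ℓ} → ℓ < i → ∃ λ C → (∀ x → x ∈ₛ C ⇔ (sz μ x ≡ i × shifted-pos x ≡ ℓ)) × ∣ C ∣ ≡ mult parts i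
    shifted-count {i@(suc i′)} {ℓ} ℓ<i =
      let C , h , eq = count-entries μ {i} e
      in C , (λ x → mk⇔
           (λ x∈ → let s≡ , q≡ = to (h x) x∈ in s≡ , trans (%-congʳ {o = pos μ x + shift} s≡) (fwd q≡))
           (λ (s≡ , q≡) → from (h x) (s≡ , bwd (subst (pos μ x <_) s≡ (pos<sz μ x))
              (trans (%-congʳ {o = pos μ x + shift} (sym s≡)) q≡)))) ,
         trans eq (mult-parts i)
      where
      open ≡-Reasoning
      -- A natural representative of ℓ - shift modulo `i`, since `i′` is -1 there.
      e = ℓ + shift * i′
      e+shift : (e + shift) % i ≡ ℓ
      e+shift = begin
        (ℓ + shift * i′ + shift) % i ≡⟨ cong (_% i) (identity ℓ shift i′) ⟩
        (ℓ + shift * i) % i          ≡⟨ [m+kn]%n≡m%n ℓ shift i ⟩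
        ℓ % i                        ≡⟨ m<n⇒m%n≡m ℓ<i ⟩
        ℓ                            ∎
        where
        identity : ∀ ℓ t i′ → ℓ + t * i′ + t ≡ ℓ + t * suc i′
        identity = solve-∀
      fwd : ∀ {q} → q ≡ e % i → (q + shift) % i ≡ ℓ
      fwd refl = trans (%-congˡ-+ (e % i) e shift i (m%n%n≡m%n e i)) e+shift
      bwd : ∀ {q} → q < i → (q + shift) % i ≡ ℓ → q ≡ e % i
      bwd {q} q<i q≡ = trans (sym (m<n⇒m%n≡m q<i)) (%-cancelʳ-+ q e shift i (trans q≡ (sym e+shift)))

    shifted-norm : ∀ {i A} → (∀ x → x ∈ₛ A ⇔ sz μ x ≡ i) → ∀ ne → shifted-pos (min A ne) < startA parts i
    shifted-norm {i} {A} h ne with refl ← subset-ext {A = A} {A[ i ]} (λ x → mk⇔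
        (from (∈⟪⟫ (λ x → sz μ x ≟ i) x) ∘ to (h x)) (from (h x) ∘ to (∈⟪⟫ (λ x → sz μ x ≟ i) x))) =
      subst (_< startA parts i) (trans (cong (λ v → (v + shift) % i) pos-min≡) (%-congʳ {o = pos μ x + shift} (sym sz≡)))
        (proj₂ (proj₂ (fillA-shift parts pos-min (maxPart parts) 1 (λ _ → 0) 0)) i
          (proj₂ (mult>0⇒bounds parts-IsPartition 0<m)) 0<m)
      where
      x = min A[ i ] ne
      sz≡ : sz μ x ≡ i
      sz≡ = to (h x) (min-∈ A[ i ] ne)
      instance i≢0 = >-nonZero (subst (0 <_) sz≡ z<s)
      pos-min≡ : pos-min i ≡ pos μ x
      pos-min≡ with nonempty? A[ i ]
      ... | yes ne′ = cong (pos μ) (min-irrelevant A[ i ] ne′ ne)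
      ... | no  em  = contradiction ne em
      0<m : 0 < mult parts i
      0<m = subst (λ k → 0 < mult parts k) sz≡ (mult-s>0 parts (sz μ) shifted-pos
        (λ x → m%n<n (pos μ x + shift) (sz μ x)) shifted-count x)

    -- Only the shifted coordinates of μ enter the construction. The o-blocks of μ′ may combine the
    -- elements differently from those of μ, which `_≡⋆_` does not see.
    ≡⋆-represented : ∃ λ M → M ∈ EnumBPiso o × ∃ λ μ′ → M represents μ′ × μ′ ≡⋆ μ
    ≡⋆-represented =
      let M , F , at = fill parts (sz μ) shifted-pos (λ x → m%n<n (pos μ x + shift) (sz μ x)) shifted-count
            o (startA parts) shifted-norm
            (maxPart parts) 1 full refl (λ x → mk⇔ (λ _ → z<s) (λ _ → ∈⊤))
          out = parts-IsPartition , F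
          μ′ , rep = Output⇒BP parts M out
      in M , from (∈-EnumBPiso {M}) (parts , out) , μ′ , rep , Shifted⇒≡⋆ μ′ μ {shift} λ x →
           let s≡ , q≡ = to (represents-At M μ′ rep) (at {x} ∈⊤)
           in sym s≡ , trans (sym q≡) (%-congʳ {o = pos μ x + shift} s≡)

theorem5 : ∀ (n : ℕ) → n ≥ 1 → (o : FixedOrders n) →
    All (λ M → ∃ λ (μ : BP n) → M represents μ) (EnumBPiso o)
    × (∀ (μ : BP n) → ∃! _≡_ λ (k : Fin (length (EnumBPiso o))) →
    ∃ λ (μ′ : BP n) → lookup (EnumBPiso o) k represents μ′ × μ′ ≡⋆ μ)
theorem5 n _ o =
  All.tabulate (λ {M} M∈ → let p , out = to (∈-EnumBPiso o {M}) M∈ in Output⇒BP o p M out) ,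
  λ μ → let M , M∈ , μ′ , rep , eq = ≡⋆-represented o μ
            M≡ = Anyₚ.lookup-index M∈
        in Any.index M∈ , (μ′ , subst (_represents μ′) M≡ rep , eq) ,
           -- Uniqueness concerns indices, so a repeated output would count twice. Two different
           -- indices would give outputs with the same coordinates, which `EnumBPiso-distinct`
           -- excludes.
           λ {k} (μ″ , rep′ , eq′) → case Any.index M∈ Finₚ.≟ k of λ
             { (yes i≡k) → i≡k
             ; (no  i≢k) → contradiction
                 (≡⋆⇒SameCoords o μ {μ′} {μ″} (∈-lookup (Any.index M∈)) (∈-lookup k) (subst (_represents μ′) M≡ rep) rep′ eq eq′)
                 (AllPairs-lookup (λ ¬same (f , g) → ¬same (g , f)) (EnumBPiso-distinct o) (Any.index M∈) k i≢k) }
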